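{- Let $n\ge 1$ be an integer and let $\boldsymbol{\xi}_k=(\xi_{1,k},\dots,\xi_{n,k})$, $k=1,2,3,\dots$, be an infinite sequence of points in $[0,1)^n$ which is well distributed. Then for almost all (with respect to Lebesgue measure) $\boldsymbol{\eta}=(\eta_1,\dots,\eta_n)\in[0,1)^n$ one has $$\liminf_{k\to\infty} k^{1/n}\max_{1\le j\le n}\|\xi_{j,k}-\eta_j\|=0.$$
   Context: For real $x$, $\|x\|=\min_{a\in\mathbb{Z}}|x-a|$ denotes the distance from $x$ to the nearest integer. For a real $C>0$, a positive integer $q$ and $\boldsymbol{\eta}=(\eta_1,\dots,\eta_n)\in[0,1)^n$, consider the box $$B_{C,q}(\boldsymbol{\eta})=\left[\eta_1,\eta_1+\frac{C}{q^{1/n}}\right)\times\cdots\times\left[\eta_n,\eta_n+\frac{C}{q^{1/n}}\right);$$ only those boxes that satisfy $B_{C,q}(\boldsymbol{\eta})\subset[0,1)^n$ are considered. Definition. An infinite sequence $\boldsymbol{\xi}_k=(\xi_{1,k},\dots,\xi_{n,k})$, $k=1,2,3,\dots$, of points in $[0,1)^n$ is called well distributed if there exist a constant $C>0$ and infinitely many positive integers $q$ such that for every box $B_{C,q}(\boldsymbol{\eta})\subset[0,1)^n$ (with $\boldsymbol{\eta}\in[0,1)^n$) there exists a positive integer $k\le q$ with $\boldsymbol{\xi}_k\in B_{C,q}(\boldsymbol{\eta})$. -}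

module Defs where

open import Data.Fin.Base as Fin using ()
open import Data.Integer.Base as ℤ using (ℤ; +_)
import Data.Integer.DivMod as ℤ
import Data.Integer.Properties as ℤ
open import Data.Nat.Base as ℕ using (ℕ; zero; suc; NonZero)
import Data.Nat.Properties as ℕ
open import Data.Nat.Coprimality using (1-coprimeTo) renaming (sym to coprime-sym)
open import Data.Product.Base using (Σ-syntax; ∃-syntax; _×_; _,_; proj₁; proj₂)
open import Data.Rational.Base as ℚ using (ℚ; mkℚ; 0ℚ; 1ℚ; ½; ↥_; ↧_; ↧ₙ_)
import Data.Rational.Properties as ℚ
import Data.Rational.Unnormalised.Base as ℚᵘ
import Data.Rational.Unnormalised.Properties as ℚᵘ
open import Data.Sum.Base using (_⊎_; inj₁; inj₂)
open import Data.Vec.Functional as Vector using (Vector)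
open import Level using (0ℓ)
open import Relation.Binary.PropositionalEquality
open import Relation.Unary using (Pred; _∈_; _∉_; _⊆_)
open import Relation.Nullary using (¬_; yes; no; contradiction)
open import Relation.Nullary.Decidable using (dec⇒maybe)
open import Tactic.RingSolver using (solve-∀)
open import Tactic.RingSolver.Core.AlmostCommutativeRing
  using (AlmostCommutativeRing; fromCommutativeRing)

------------------------------------------------------------------------
-- Real numbers, as Cauchy sequences of rationals

IsCauchy : (ℕ → ℚ) → Set
IsCauchy s = ∀ ε → 0ℚ ℚ.< ε → ∃[ N ] ∀ m n → N ℕ.≤ m → N ℕ.≤ n →
  ℚ.∣ s m ℚ.- s n ∣ ℚ.< ε

-- Two Cauchy sequences with the same limit are not identified by _≡_;
-- every relation on ℝ below depends on the limits only.
record ℝ : Set where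
  constructor mkℝ
  field
    seq    : ℕ → ℚ
    cauchy : IsCauchy seq

open ℝ public

infix 4 _<_ _≤_

_<_ : ℝ → ℝ → Set
x < y = ∃[ ε ] (0ℚ ℚ.< ε) × (∃[ N ] ∀ m → N ℕ.≤ m → seq x m ℚ.+ ε ℚ.≤ seq y m)

_≤_ : ℝ → ℝ → Set
x ≤ y = ¬ (y < x)

halve : ∀ ε → 0ℚ ℚ.< ε → ∃[ δ ] (0ℚ ℚ.< δ) × (δ ℚ.+ δ ≡ ε)
halve ε 0<ε = ½ ℚ.* ε
  , ℚ.positive⁻¹ (½ ℚ.* ε) {{ℚ.pos*pos⇒pos ½ ε {{ℚ.positive 0<ε}}}}
  , trans (sym (ℚ.*-distribʳ-+ ε ½ ½)) (ℚ.*-identityˡ ε)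

ℚ-ring : AlmostCommutativeRing _ _
ℚ-ring = fromCommutativeRing ℚ.+-*-commutativeRing (λ p → dec⇒maybe (0ℚ ℚ.≟ p))

y+[x-y]≡x : ∀ x y → y ℚ.+ (x ℚ.- y) ≡ x
y+[x-y]≡x = solve-∀ ℚ-ring

[y+ε]-y≡ε : ∀ y ε → (y ℚ.+ ε) ℚ.- y ≡ ε
[y+ε]-y≡ε = solve-∀ ℚ-ring

-[x-y]≡y-x : ∀ x y → ℚ.- (x ℚ.- y) ≡ y ℚ.- x
-[x-y]≡y-x = solve-∀ ℚ-ring

x-y≡-y--x : ∀ x y → x ℚ.- y ≡ ℚ.- y ℚ.- ℚ.- x
x-y≡-y--x = solve-∀ ℚ-ring

+-shuffle : ∀ x y ε → (x ℚ.+ ε) ℚ.+ (y ℚ.+ ε) ≡ (x ℚ.+ y) ℚ.+ (ε ℚ.+ ε)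
+-shuffle = solve-∀ ℚ-ring

telescope : ∀ x y z → x ℚ.- z ≡ (y ℚ.- z) ℚ.+ (x ℚ.- y)
telescope = solve-∀ ℚ-ring

*-split : ∀ a b c d → a ℚ.* b ℚ.- c ℚ.* d ≡ a ℚ.* (b ℚ.- d) ℚ.+ d ℚ.* (a ℚ.- c)
*-split = solve-∀ ℚ-ring

p≤∣p∣ : ∀ p → p ℚ.≤ ℚ.∣ p ∣
p≤∣p∣ p with ℚ.≤-total 0ℚ p
... | inj₁ 0≤p = ℚ.≤-reflexive (sym (ℚ.0≤p⇒∣p∣≡p 0≤p))
... | inj₂ p≤0 = ℚ.≤-trans p≤0 (ℚ.0≤∣p∣ p)

∣x-y∣≡∣y-x∣ : ∀ x y → ℚ.∣ x ℚ.- y ∣ ≡ ℚ.∣ y ℚ.- x ∣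
∣x-y∣≡∣y-x∣ x y = trans (sym (ℚ.∣-p∣≡∣p∣ (x ℚ.- y))) (cong ℚ.∣_∣ (-[x-y]≡y-x x y))

x≤y+∣x-y∣ : ∀ x y → x ℚ.≤ y ℚ.+ ℚ.∣ x ℚ.- y ∣
x≤y+∣x-y∣ x y = subst (ℚ._≤ y ℚ.+ ℚ.∣ x ℚ.- y ∣) (y+[x-y]≡x x y)
  (ℚ.+-monoʳ-≤ y (p≤∣p∣ (x ℚ.- y)))

<+⇒-< : ∀ x y {ε} → x ℚ.< y ℚ.+ ε → x ℚ.- y ℚ.< ε
<+⇒-< x y {ε} h = subst (x ℚ.- y ℚ.<_) ([y+ε]-y≡ε y ε) (ℚ.+-monoˡ-< (ℚ.- y) h)

∣-∣<⁺ : ∀ x y {ε} → x ℚ.< y ℚ.+ ε → y ℚ.< x ℚ.+ ε → ℚ.∣ x ℚ.- y ∣ ℚ.< ε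
∣-∣<⁺ x y {ε} h₁ h₂ with ℚ.∣p∣≡p∨∣p∣≡-p (x ℚ.- y)
... | inj₁ e = subst (ℚ._< ε) (sym e) (<+⇒-< x y h₁)
... | inj₂ e = subst (ℚ._< ε) (sym (trans e (-[x-y]≡y-x x y))) (<+⇒-< y x h₂)

∣-∣<⁻ : ∀ x y {ε} → ℚ.∣ x ℚ.- y ∣ ℚ.< ε → x ℚ.< y ℚ.+ ε
∣-∣<⁻ x y h = ℚ.≤-<-trans (x≤y+∣x-y∣ x y) (ℚ.+-monoʳ-< y h)

IsCauchy₁ : (ℕ → ℚ) → Set
IsCauchy₁ s = ∀ ε → 0ℚ ℚ.< ε → ∃[ N ] ∀ m n → N ℕ.≤ m → N ℕ.≤ n →
  s m ℚ.< s n ℚ.+ ε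

cauchy⁺ : ∀ {s} → IsCauchy₁ s → IsCauchy s
cauchy⁺ {s} c ε 0<ε with c ε 0<ε
... | N , h = N , λ m n N≤m N≤n → ∣-∣<⁺ (s m) (s n) (h m n N≤m N≤n) (h n m N≤n N≤m)

cauchy⁻ : ∀ {s} → IsCauchy s → IsCauchy₁ s
cauchy⁻ {s} c ε 0<ε with c ε 0<ε
... | N , h = N , λ m n N≤m N≤n → ∣-∣<⁻ (s m) (s n) (h m n N≤m N≤n)

fromℚ : ℚ → ℝ
fromℚ p = mkℝ (λ _ → p) λ ε 0<ε → 0 , λ _ _ _ _ →
  subst (ℚ._< ε) (sym (cong ℚ.∣_∣ (ℚ.+-inverseʳ p))) 0<ε

0ℝ 1ℝ : ℝ
0ℝ = fromℚ 0ℚ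
1ℝ = fromℚ 1ℚ

-- The operations are opaque so that the type checker does not unfold the
-- underlying rational arithmetic.
infixl 6 _+_ _-_ _⊔_
infixl 7 _*_
infix  8 -_

+-<-+ : ∀ a b c d δ ε → δ ℚ.+ δ ≡ ε → a ℚ.< c ℚ.+ δ → b ℚ.< d ℚ.+ δ →
        a ℚ.+ b ℚ.< (c ℚ.+ d) ℚ.+ ε
+-<-+ a b c d δ _ refl h₁ h₂ = subst (a ℚ.+ b ℚ.<_) (+-shuffle c d δ)
  (ℚ.+-mono-< {a} {c ℚ.+ δ} {b} {d ℚ.+ δ} h₁ h₂)

opaque
  _+_ : ℝ → ℝ → ℝ
  x + y = mkℝ (λ m → seq x m ℚ.+ seq y m) (cauchy⁺ {λ m → seq x m ℚ.+ seq y m} c)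
    where
    c : IsCauchy₁ (λ m → seq x m ℚ.+ seq y m)
    c ε 0<ε =
      let δ , 0<δ , 2δ≡ε = halve ε 0<ε
          M , f = cauchy⁻ {seq x} (cauchy x) δ 0<δ
          N , g = cauchy⁻ {seq y} (cauchy y) δ 0<δ
      in M ℕ.⊔ N , λ m n p q →
      +-<-+ (seq x m) (seq y m) (seq x n) (seq y n) δ ε 2δ≡ε
        (f m n (ℕ.m⊔n≤o⇒m≤o M N p) (ℕ.m⊔n≤o⇒m≤o M N q))
        (g m n (ℕ.m⊔n≤o⇒n≤o M N p) (ℕ.m⊔n≤o⇒n≤o M N q))

opaque
  -_ : ℝ → ℝ
  - x = mkℝ (λ m → ℚ.- seq x m) λ ε 0<ε → let (N , h) = cauchy x ε 0<ε in
    N , λ m n N≤m N≤n →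
      subst (ℚ._< ε) (cong ℚ.∣_∣ (x-y≡-y--x (seq x n) (seq x m))) (h n m N≤n N≤m)

_-_ : ℝ → ℝ → ℝ
x - y = x + - y

⊔-<-+ : ∀ a b c d ε → a ℚ.< c ℚ.+ ε → b ℚ.< d ℚ.+ ε →
        a ℚ.⊔ b ℚ.< (c ℚ.⊔ d) ℚ.+ ε
⊔-<-+ a b c d ε h₁ h₂ with ℚ.⊔-sel a b
... | inj₁ e = subst (ℚ._< (c ℚ.⊔ d) ℚ.+ ε) (sym e)
  (ℚ.<-≤-trans h₁ (ℚ.+-monoˡ-≤ ε (ℚ.p≤p⊔q c d)))
... | inj₂ e = subst (ℚ._< (c ℚ.⊔ d) ℚ.+ ε) (sym e)
  (ℚ.<-≤-trans h₂ (ℚ.+-monoˡ-≤ ε (ℚ.p≤q⊔p c d)))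

opaque
  _⊔_ : ℝ → ℝ → ℝ
  x ⊔ y = mkℝ (λ m → seq x m ℚ.⊔ seq y m) (cauchy⁺ {λ m → seq x m ℚ.⊔ seq y m} c)
    where
    c : IsCauchy₁ (λ m → seq x m ℚ.⊔ seq y m)
    c ε 0<ε =
      let M , f = cauchy⁻ {seq x} (cauchy x) ε 0<ε
          N , g = cauchy⁻ {seq y} (cauchy y) ε 0<ε
      in M ℕ.⊔ N , λ m n p q → ⊔-<-+ (seq x m) (seq y m) (seq x n) (seq y n) ε
      (f m n (ℕ.m⊔n≤o⇒m≤o M N p) (ℕ.m⊔n≤o⇒m≤o M N q))
      (g m n (ℕ.m⊔n≤o⇒n≤o M N p) (ℕ.m⊔n≤o⇒n≤o M N q))

bounded : ∀ x → ∃[ B ] (1ℚ ℚ.≤ B) × (∃[ N ] ∀ m → N ℕ.≤ m → ℚ.∣ seq x m ∣ ℚ.≤ B)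
bounded x with cauchy x 1ℚ (ℚ.positive⁻¹ 1ℚ)
... | N , h = ℚ.∣ seq x N ∣ ℚ.+ 1ℚ , 1≤B , N , λ m N≤m → begin
    ℚ.∣ seq x m ∣                                ≡⟨ cong ℚ.∣_∣ (sym (y+[x-y]≡x (seq x m) (seq x N))) ⟩
    ℚ.∣ seq x N ℚ.+ (seq x m ℚ.- seq x N) ∣       ≤⟨ ℚ.∣p+q∣≤∣p∣+∣q∣ (seq x N) _ ⟩
    ℚ.∣ seq x N ∣ ℚ.+ ℚ.∣ seq x m ℚ.- seq x N ∣   ≤⟨ ℚ.+-monoʳ-≤ ℚ.∣ seq x N ∣ (ℚ.<⇒≤ (h m N N≤m ℕ.≤-refl)) ⟩
    ℚ.∣ seq x N ∣ ℚ.+ 1ℚ                         ∎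
  where
  open ℚ.≤-Reasoning
  1≤B : 1ℚ ℚ.≤ ℚ.∣ seq x N ∣ ℚ.+ 1ℚ
  1≤B = subst (ℚ._≤ ℚ.∣ seq x N ∣ ℚ.+ 1ℚ) (ℚ.+-identityˡ 1ℚ)
          (ℚ.+-monoˡ-≤ 1ℚ (ℚ.0≤∣p∣ (seq x N)))

*-bound : ∀ a b B δ → .{{ℚ.Positive B}} → ℚ.∣ a ∣ ℚ.≤ B → ℚ.∣ b ∣ ℚ.< δ →
          ℚ.∣ a ℚ.* b ∣ ℚ.< B ℚ.* δ
*-bound a b B δ a≤B b<δ = begin-strict
  ℚ.∣ a ℚ.* b ∣            ≡⟨ ℚ.∣p*q∣≡∣p∣*∣q∣ a b ⟩
  ℚ.∣ a ∣ ℚ.* ℚ.∣ b ∣       ≤⟨ ℚ.*-monoʳ-≤-nonNeg ℚ.∣ b ∣ {{ℚ.∣-∣-nonNeg b}} a≤B ⟩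
  B ℚ.* ℚ.∣ b ∣            <⟨ ℚ.*-monoʳ-<-pos B b<δ ⟩
  B ℚ.* δ                 ∎
  where open ℚ.≤-Reasoning

*-close : ∀ A B a b c d δ₁ δ₂ η ε → .{{ℚ.Positive A}} → .{{ℚ.Positive B}} →
          A ℚ.* δ₁ ≡ η → B ℚ.* δ₂ ≡ η → η ℚ.+ η ≡ ε →
          ℚ.∣ a ∣ ℚ.≤ A → ℚ.∣ b ℚ.- d ∣ ℚ.< δ₁ →
          ℚ.∣ d ∣ ℚ.≤ B → ℚ.∣ a ℚ.- c ∣ ℚ.< δ₂ →
          ℚ.∣ a ℚ.* b ℚ.- c ℚ.* d ∣ ℚ.< ε
*-close A B a b c d δ₁ δ₂ η ε e₁ e₂ e₃ a≤A b~d d≤B a~c = begin-strict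
  ℚ.∣ a ℚ.* b ℚ.- c ℚ.* d ∣
    ≡⟨ cong ℚ.∣_∣ (*-split a b c d) ⟩
  ℚ.∣ a ℚ.* (b ℚ.- d) ℚ.+ d ℚ.* (a ℚ.- c) ∣
    ≤⟨ ℚ.∣p+q∣≤∣p∣+∣q∣ (a ℚ.* (b ℚ.- d)) (d ℚ.* (a ℚ.- c)) ⟩
  ℚ.∣ a ℚ.* (b ℚ.- d) ∣ ℚ.+ ℚ.∣ d ℚ.* (a ℚ.- c) ∣
    <⟨ ℚ.+-mono-< {ℚ.∣ a ℚ.* (b ℚ.- d) ∣} {A ℚ.* δ₁} {ℚ.∣ d ℚ.* (a ℚ.- c) ∣} {B ℚ.* δ₂}
         (*-bound a (b ℚ.- d) A δ₁ a≤A b~d) (*-bound d (a ℚ.- c) B δ₂ d≤B a~c) ⟩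
  A ℚ.* δ₁ ℚ.+ B ℚ.* δ₂
    ≡⟨ cong₂ ℚ._+_ e₁ e₂ ⟩
  η ℚ.+ η
    ≡⟨ e₃ ⟩
  ε ∎
  where open ℚ.≤-Reasoning

quotient : ∀ A η → 1ℚ ℚ.≤ A → 0ℚ ℚ.< η → ∃[ δ ] (0ℚ ℚ.< δ) × (A ℚ.* δ ≡ η)
quotient A η 1≤A 0<η = ℚ.1/ A ℚ.* η
  , ℚ.positive⁻¹ (ℚ.1/ A ℚ.* η)
      {{ℚ.pos*pos⇒pos (ℚ.1/ A) {{ℚ.1/pos⇒pos A}} η {{ℚ.positive 0<η}}}}
  , trans (sym (ℚ.*-assoc A (ℚ.1/ A) η))
      (trans (cong (ℚ._* η) (ℚ.*-inverseʳ A)) (ℚ.*-identityˡ η))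
  where
  instance
    A>0 : ℚ.Positive A
    A>0 = ℚ.positive (ℚ.<-≤-trans (ℚ.positive⁻¹ 1ℚ) 1≤A)
    A≢0 : ℚ.NonZero A
    A≢0 = ℚ.pos⇒nonZero A

opaque
  _*_ : ℝ → ℝ → ℝ
  x * y = mkℝ (λ m → seq x m ℚ.* seq y m) c
    where
    c : IsCauchy (λ m → seq x m ℚ.* seq y m)
    c ε 0<ε =
      let η , 0<η , 2η≡ε = halve ε 0<ε
          A , 1≤A , K , x≤A = bounded x
          B , 1≤B , L , y≤B = bounded y
          δ₁ , 0<δ₁ , e₁ = quotient A η 1≤A 0<η
          δ₂ , 0<δ₂ , e₂ = quotient B η 1≤B 0<η
          M , f = cauchy x δ₂ 0<δ₂
          N , g = cauchy y δ₁ 0<δ₁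
      in (K ℕ.⊔ L) ℕ.⊔ (M ℕ.⊔ N) , λ m n p q →
      *-close A B (seq x m) (seq y m) (seq x n) (seq y n) δ₁ δ₂ η ε
        {{ℚ.positive (ℚ.<-≤-trans (ℚ.positive⁻¹ 1ℚ) 1≤A)}}
        {{ℚ.positive (ℚ.<-≤-trans (ℚ.positive⁻¹ 1ℚ) 1≤B)}}
        e₁ e₂ 2η≡ε
        (x≤A m (ℕ.m⊔n≤o⇒m≤o K L (ℕ.m⊔n≤o⇒m≤o (K ℕ.⊔ L) (M ℕ.⊔ N) p)))
        (g m n (ℕ.m⊔n≤o⇒n≤o M N (ℕ.m⊔n≤o⇒n≤o (K ℕ.⊔ L) (M ℕ.⊔ N) p))
               (ℕ.m⊔n≤o⇒n≤o M N (ℕ.m⊔n≤o⇒n≤o (K ℕ.⊔ L) (M ℕ.⊔ N) q)))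
        (y≤B n (ℕ.m⊔n≤o⇒n≤o K L (ℕ.m⊔n≤o⇒m≤o (K ℕ.⊔ L) (M ℕ.⊔ N) q)))
        (f m n (ℕ.m⊔n≤o⇒m≤o M N (ℕ.m⊔n≤o⇒n≤o (K ℕ.⊔ L) (M ℕ.⊔ N) p))
               (ℕ.m⊔n≤o⇒m≤o M N (ℕ.m⊔n≤o⇒n≤o (K ℕ.⊔ L) (M ℕ.⊔ N) q)))

------------------------------------------------------------------------
-- Distance to the nearest integer

ℤ→ℚ : ℤ → ℚ
ℤ→ℚ i = i ℚ./ 1

-- The nearest integer is one of the two neighbours ⌊ p ⌋ and ⌊ p ⌋ + 1.
distℤ : ℚ → ℚ
distℤ p = (p ℚ.- ℤ→ℚ (ℚ.floor p)) ℚ.⊓ (ℤ→ℚ (ℤ.suc (ℚ.floor p)) ℚ.- p)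

ℤ→ℚ≡ : ∀ i → ℤ→ℚ i ≡ mkℚ i 0 (coprime-sym (1-coprimeTo ℤ.∣ i ∣))
ℤ→ℚ≡ i = ℚ.↥p/↧p≡p (mkℚ i 0 (coprime-sym (1-coprimeTo ℤ.∣ i ∣)))

ℤ→ℚ-mono : ∀ {i j} → i ℤ.≤ j → ℤ→ℚ i ℚ.≤ ℤ→ℚ j
ℤ→ℚ-mono {i} {j} i≤j = subst₂ ℚ._≤_ (sym (ℤ→ℚ≡ i)) (sym (ℤ→ℚ≡ j))
  (ℚ.*≤* (subst₂ ℤ._≤_ (sym (ℤ.*-identityʳ i)) (sym (ℤ.*-identityʳ j)) i≤j))

floor-≤ : ∀ p → ℤ→ℚ (ℚ.floor p) ℚ.≤ p
floor-≤ p@record{} = subst (ℚ._≤ p) (sym (ℤ→ℚ≡ (ℚ.floor p)))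
  (ℚ.*≤* (subst (ℚ.floor p ℤ.* ↧ p ℤ.≤_) (sym (ℤ.*-identityʳ (↥ p)))
    (ℤ.[n/d]*d≤n (↥ p) (↧ p))))

≤-suc-floor : ∀ p → p ℚ.≤ ℤ→ℚ (ℤ.suc (ℚ.floor p))
≤-suc-floor p@record{} = subst (p ℚ.≤_) (sym (ℤ→ℚ≡ (ℤ.suc (ℚ.floor p))))
  (ℚ.*≤* (subst₂ ℤ._≤_ (sym (ℤ.*-identityʳ (↥ p)))
    (cong (λ z → ℤ.suc z ℤ.* ↧ p) (sym (ℤ.div-pos-is-/ℕ (↥ p) (↧ₙ p))))
    (ℤ.<⇒≤ (ℤ.n<s[n/ℕd]*d (↥ p) (↧ₙ p)))))

p-q≡∣p-q∣ : ∀ {p q} → q ℚ.≤ p → p ℚ.- q ≡ ℚ.∣ p ℚ.- q ∣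
p-q≡∣p-q∣ {p} {q} q≤p = sym (ℚ.0≤p⇒∣p∣≡p
  (subst (ℚ._≤ p ℚ.- q) (ℚ.+-inverseʳ q) (ℚ.+-monoˡ-≤ (ℚ.- q) q≤p)))

-- distℤ p = min { ∣ p - a ∣ : a ∈ ℤ }
distℤ-≤ : ∀ p a → distℤ p ℚ.≤ ℚ.∣ p ℚ.- ℤ→ℚ a ∣
distℤ-≤ p a with a ℤ.≤? ℚ.floor p
... | yes a≤⌊p⌋ = begin
  distℤ p                     ≤⟨ ℚ.p⊓q≤p (p ℚ.- ℤ→ℚ (ℚ.floor p)) _ ⟩
  p ℚ.- ℤ→ℚ (ℚ.floor p)       ≤⟨ ℚ.+-monoʳ-≤ p (ℚ.neg-antimono-≤ (ℤ→ℚ-mono a≤⌊p⌋)) ⟩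
  p ℚ.- ℤ→ℚ a                 ≤⟨ p≤∣p∣ _ ⟩
  ℚ.∣ p ℚ.- ℤ→ℚ a ∣           ∎
  where open ℚ.≤-Reasoning
... | no a≰⌊p⌋ = begin
  distℤ p                            ≤⟨ ℚ.p⊓q≤q (p ℚ.- ℤ→ℚ (ℚ.floor p)) _ ⟩
  ℤ→ℚ (ℤ.suc (ℚ.floor p)) ℚ.- p      ≤⟨ ℚ.+-monoˡ-≤ (ℚ.- p) (ℤ→ℚ-mono (ℤ.i<j⇒suc[i]≤j (ℤ.≰⇒> a≰⌊p⌋))) ⟩
  ℤ→ℚ a ℚ.- p                        ≤⟨ p≤∣p∣ _ ⟩
  ℚ.∣ ℤ→ℚ a ℚ.- p ∣                  ≡⟨ ∣x-y∣≡∣y-x∣ (ℤ→ℚ a) p ⟩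
  ℚ.∣ p ℚ.- ℤ→ℚ a ∣                  ∎
  where open ℚ.≤-Reasoning

distℤ-attained : ∀ p → ∃[ a ] distℤ p ≡ ℚ.∣ p ℚ.- ℤ→ℚ a ∣
distℤ-attained p = go (ℚ.⊓-sel (p ℚ.- ℤ→ℚ ⌊p⌋) (ℤ→ℚ (ℤ.suc ⌊p⌋) ℚ.- p))
  where
  ⌊p⌋ = ℚ.floor p
  go : distℤ p ≡ p ℚ.- ℤ→ℚ ⌊p⌋ ⊎ distℤ p ≡ ℤ→ℚ (ℤ.suc ⌊p⌋) ℚ.- p →
       ∃[ a ] distℤ p ≡ ℚ.∣ p ℚ.- ℤ→ℚ a ∣
  go (inj₁ e) = ⌊p⌋ , trans e (p-q≡∣p-q∣ (floor-≤ p))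
  go (inj₂ e) = ℤ.suc ⌊p⌋ , trans e (trans (p-q≡∣p-q∣ (≤-suc-floor p))
    (∣x-y∣≡∣y-x∣ (ℤ→ℚ (ℤ.suc ⌊p⌋)) p))

distℤ-lipschitz : ∀ p q → distℤ p ℚ.≤ distℤ q ℚ.+ ℚ.∣ p ℚ.- q ∣
distℤ-lipschitz p q = go (distℤ-attained q)
  where
  open ℚ.≤-Reasoning
  go : ∃[ a ] distℤ q ≡ ℚ.∣ q ℚ.- ℤ→ℚ a ∣ → distℤ p ℚ.≤ distℤ q ℚ.+ ℚ.∣ p ℚ.- q ∣
  go (a , e) = begin
    distℤ p                                       ≤⟨ distℤ-≤ p a ⟩
    ℚ.∣ p ℚ.- ℤ→ℚ a ∣                             ≡⟨ cong ℚ.∣_∣ (telescope p q (ℤ→ℚ a)) ⟩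
    ℚ.∣ (q ℚ.- ℤ→ℚ a) ℚ.+ (p ℚ.- q) ∣             ≤⟨ ℚ.∣p+q∣≤∣p∣+∣q∣ (q ℚ.- ℤ→ℚ a) (p ℚ.- q) ⟩
    ℚ.∣ q ℚ.- ℤ→ℚ a ∣ ℚ.+ ℚ.∣ p ℚ.- q ∣           ≡⟨ cong (ℚ._+ ℚ.∣ p ℚ.- q ∣) (sym e) ⟩
    distℤ q ℚ.+ ℚ.∣ p ℚ.- q ∣                     ∎

opaque
  ‖_‖ : ℝ → ℝ
  ‖ x ‖ = mkℝ (λ m → distℤ (seq x m)) (cauchy⁺ {λ m → distℤ (seq x m)} c)
    where
    c : IsCauchy₁ (λ m → distℤ (seq x m))
    c ε 0<ε = let N , h = cauchy x ε 0<ε in N , λ m n p q →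
      ℚ.≤-<-trans (distℤ-lipschitz (seq x m) (seq x n))
        (ℚ.+-monoʳ-< (distℤ (seq x n)) (h m n p q))

------------------------------------------------------------------------
-- Roots

-- The largest a ≤ b with (a / M)ⁿ ≤ u / v.
rootSearch : (n u v M b : ℕ) → ℕ
rootSearch n u v M zero    = zero
rootSearch n u v M (suc b) with suc b ℕ.^ n ℕ.* v ℕ.≤? u ℕ.* M ℕ.^ n
... | yes _ = suc b
... | no  _ = rootSearch n u v M b

-- ⌊ M (u / v)^(1/n) ⌋, which never exceeds u M.
rootFloor : (n u v M : ℕ) → ℕ
rootFloor n u v M = rootSearch n u v M (u ℕ.* M)

rootSearch-≤ : ∀ n u v M b .{{_ : NonZero n}} →
  rootSearch n u v M b ℕ.^ n ℕ.* v ℕ.≤ u ℕ.* M ℕ.^ n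
rootSearch-≤ (suc n) u v M zero = ℕ.z≤n
rootSearch-≤ n u v M (suc b) with suc b ℕ.^ n ℕ.* v ℕ.≤? u ℕ.* M ℕ.^ n
... | yes h = h
... | no  _ = rootSearch-≤ n u v M b

rootSearch-max : ∀ n u v M b → rootSearch n u v M b ≡ b ⊎
  u ℕ.* M ℕ.^ n ℕ.< suc (rootSearch n u v M b) ℕ.^ n ℕ.* v
rootSearch-max n u v M zero = inj₁ refl
rootSearch-max n u v M (suc b) with suc b ℕ.^ n ℕ.* v ℕ.≤? u ℕ.* M ℕ.^ n
... | yes _ = inj₁ refl
... | no ¬h with rootSearch-max n u v M b
...   | inj₂ h = inj₂ h
...   | inj₁ e = inj₂ (subst (λ a → u ℕ.* M ℕ.^ n ℕ.< suc a ℕ.^ n ℕ.* v) (sym e) (ℕ.≰⇒> ¬h))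

k≤k^n : ∀ k n .{{_ : NonZero n}} → k ℕ.≤ k ℕ.^ n
k≤k^n zero    n       = ℕ.z≤n
k≤k^n (suc k) (suc n) = ℕ.m≤m*n (suc k) (suc k ℕ.^ n) {{ℕ.m^n≢0 (suc k) n}}

^-distrib-* : ∀ k l n → k ℕ.^ n ℕ.* l ℕ.^ n ≡ (k ℕ.* l) ℕ.^ n
^-distrib-* k l zero    = refl
^-distrib-* k l (suc n) = trans (ℕ.[m*n]*[o*p]≡[m*o]*[n*p] k (k ℕ.^ n) l (l ℕ.^ n))
  (cong (k ℕ.* l ℕ.*_) (^-distrib-* k l n))

<-rootFloor : ∀ n u v M .{{_ : NonZero n}} .{{_ : NonZero v}} →
  u ℕ.* M ℕ.^ n ℕ.< suc (rootFloor n u v M) ℕ.^ n ℕ.* v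
<-rootFloor n u v M with rootSearch-max n u v M (u ℕ.* M)
... | inj₂ h = h
... | inj₁ e = subst (λ a → u ℕ.* M ℕ.^ n ℕ.< suc a ℕ.^ n ℕ.* v) (sym e) (begin-strict
  u ℕ.* M ℕ.^ n                  ≤⟨ ℕ.*-monoˡ-≤ (M ℕ.^ n) (k≤k^n u n) ⟩
  u ℕ.^ n ℕ.* M ℕ.^ n            ≡⟨ ^-distrib-* u M n ⟩
  (u ℕ.* M) ℕ.^ n                <⟨ ℕ.^-monoˡ-< n (ℕ.n<1+n (u ℕ.* M)) ⟩
  suc (u ℕ.* M) ℕ.^ n            ≤⟨ ℕ.m≤m*n (suc (u ℕ.* M) ℕ.^ n) v ⟩
  suc (u ℕ.* M) ℕ.^ n ℕ.* v      ∎)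
  where open ℕ.≤-Reasoning

rootFloor-close : ∀ n u v M K .{{_ : NonZero n}} .{{_ : NonZero v}} .{{_ : NonZero M}} →
  rootFloor n u v M ℕ.* K ℕ.< suc (rootFloor n u v K) ℕ.* M
rootFloor-close n u v M K = ℕ.≰⇒> λ h → ℕ.<-irrefl refl (begin-strict
  (u ℕ.* K ℕ.^ n) ℕ.* M ℕ.^ n
    <⟨ ℕ.*-monoˡ-< (M ℕ.^ n) {{ℕ.m^n≢0 M n}} (<-rootFloor n u v K) ⟩
  (suc b ℕ.^ n ℕ.* v) ℕ.* M ℕ.^ n
    ≡⟨ swap (suc b ℕ.^ n) v (M ℕ.^ n) ⟩
  (suc b ℕ.^ n ℕ.* M ℕ.^ n) ℕ.* v
    ≡⟨ cong (ℕ._* v) (^-distrib-* (suc b) M n) ⟩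
  (suc b ℕ.* M) ℕ.^ n ℕ.* v
    ≤⟨ ℕ.*-monoˡ-≤ v (ℕ.^-monoˡ-≤ n h) ⟩
  (a ℕ.* K) ℕ.^ n ℕ.* v
    ≡⟨ cong (ℕ._* v) (sym (^-distrib-* a K n)) ⟩
  (a ℕ.^ n ℕ.* K ℕ.^ n) ℕ.* v
    ≡⟨ swap (a ℕ.^ n) (K ℕ.^ n) v ⟩
  (a ℕ.^ n ℕ.* v) ℕ.* K ℕ.^ n
    ≤⟨ ℕ.*-monoˡ-≤ (K ℕ.^ n) (rootSearch-≤ n u v M (u ℕ.* M)) ⟩
  (u ℕ.* M ℕ.^ n) ℕ.* K ℕ.^ n
    ≡⟨ swap u (M ℕ.^ n) (K ℕ.^ n) ⟩
  (u ℕ.* K ℕ.^ n) ℕ.* M ℕ.^ n ∎)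
  where
  open ℕ.≤-Reasoning
  a = rootFloor n u v M
  b = rootFloor n u v K
  swap : ∀ k l m → k ℕ.* l ℕ.* m ≡ k ℕ.* m ℕ.* l
  swap k l m = trans (ℕ.*-assoc k l m)
    (trans (cong (k ℕ.*_) (ℕ.*-comm l m)) (sym (ℕ.*-assoc k m l)))

frac-< : ∀ a b M K ε .{{_ : NonZero M}} .{{_ : NonZero K}} → 0ℚ ℚ.< ε → ↧ₙ ε ℕ.≤ K →
  a ℕ.* K ℕ.< suc b ℕ.* M → + a ℚ./ M ℚ.< (+ b ℚ./ K) ℚ.+ ε
frac-< a b M@(suc M-1) K@(suc K-1) (mkℚ (+ zero) _ _) 0<ε _ _ =
  contradiction (ℚ.positive 0<ε) λ ()
frac-< a b M@(suc M-1) K@(suc K-1) (mkℚ (ℤ.-[1+ _ ]) _ _) 0<ε _ _ =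
  contradiction (ℚ.positive 0<ε) λ ()
frac-< a b M@(suc M-1) K@(suc K-1) ε@(mkℚ (+ p@(suc _)) d-1 _) 0<ε d≤K h =
  ℚ.toℚᵘ-cancel-< (begin-strict
    ℚ.toℚᵘ (+ a ℚ./ M)                    ≃⟨ ℚ.toℚᵘ-fromℚᵘ (ℚᵘ.mkℚᵘ (+ a) M-1) ⟩
    ℚᵘ.mkℚᵘ (+ a) M-1                     <⟨ ℚᵘ.*<* step ⟩
    ℚᵘ.mkℚᵘ (+ b) K-1 ℚᵘ.+ ℚ.toℚᵘ ε       ≃⟨ ℚᵘ.+-congˡ (ℚ.toℚᵘ ε) (ℚᵘ.≃-sym (ℚ.toℚᵘ-fromℚᵘ (ℚᵘ.mkℚᵘ (+ b) K-1))) ⟩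
    ℚ.toℚᵘ (+ b ℚ./ K) ℚᵘ.+ ℚ.toℚᵘ ε      ≃⟨ ℚᵘ.≃-sym (ℚ.toℚᵘ-homo-+ (+ b ℚ./ K) ε) ⟩
    ℚ.toℚᵘ ((+ b ℚ./ K) ℚ.+ ε)            ∎)
  where
  open ℚᵘ.≤-Reasoning
  d = suc d-1
  cross : a ℕ.* (K ℕ.* d) ℕ.< (b ℕ.* d ℕ.+ p ℕ.* K) ℕ.* M
  cross = ℕ.<-≤-trans
    (subst₂ ℕ._<_ (ℕ.*-assoc a K d) (trans (ℕ.*-assoc (suc b) M d)
        (trans (cong (suc b ℕ.*_) (ℕ.*-comm M d)) (sym (ℕ.*-assoc (suc b) d M))))
      (ℕ.*-monoˡ-< d h))
    (ℕ.*-monoˡ-≤ M (ℕ.≤-trans (ℕ.≤-reflexive (ℕ.+-comm d (b ℕ.* d)))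
      (ℕ.+-monoʳ-≤ (b ℕ.* d) (ℕ.≤-trans d≤K (ℕ.m≤n*m K p)))))
  step : + a ℤ.* + (K ℕ.* d) ℤ.< (+ b ℤ.* + d ℤ.+ + p ℤ.* + K) ℤ.* + M
  step = subst₂ ℤ._<_ (ℤ.pos-* a (K ℕ.* d))
    (trans (ℤ.pos-* (b ℕ.* d ℕ.+ p ℕ.* K) M) (cong (ℤ._* + M)
      (trans (ℤ.pos-+ (b ℕ.* d) (p ℕ.* K)) (cong₂ ℤ._+_ (ℤ.pos-* b d) (ℤ.pos-* p K)))))
    (ℤ.+<+ cross)

-- (u / v)^(1/n), whose m-th term is the largest multiple of 1 / (m + 1)
-- not exceeding it.
opaque
  root : (n u v : ℕ) → .{{NonZero n}} → .{{NonZero v}} → ℝ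
  root n u v = mkℝ s (cauchy⁺ {s} c)
    where
    s : ℕ → ℚ
    s m = + rootFloor n u v (suc m) ℚ./ suc m
    c : IsCauchy₁ s
    c ε 0<ε = ↧ₙ ε , λ m k _ d≤k →
      frac-< (rootFloor n u v (suc m)) (rootFloor n u v (suc k)) (suc m) (suc k) ε 0<ε
        (ℕ.m≤n⇒m≤1+n d≤k) (rootFloor-close n u v (suc m) (suc k))

------------------------------------------------------------------------
-- Finite products and maxima, partial sums, lower limits

product : ∀ {n} → Vector ℝ n → ℝ
product = Vector.foldr _*_ 1ℝ

maximum : ∀ {n} .{{_ : NonZero n}} → Vector ℝ n → ℝ
maximum {suc zero}    f = f Fin.zero
maximum {suc (suc n)} f = f Fin.zero ⊔ maximum (Vector.tail f)

partialSum : (ℕ → ℝ) → ℕ → ℝ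
partialSum f zero    = 0ℝ
partialSum f (suc m) = partialSum f m + f m

-- liminf a = L, for a finite L.
IsLimInf : (ℕ → ℝ) → ℝ → Set
IsLimInf a L = ∀ ε → 0ℝ < ε →
  (∃[ N ] ∀ k → N ℕ.≤ k → L - ε < a k) ×
  (∀ N → ∃[ k ] (N ℕ.≤ k) × (a k < L + ε))

------------------------------------------------------------------------
-- Boxes and Lebesgue null sets in ℝⁿ

Point : ℕ → Set
Point = Vector ℝ

-- [ lo₁ , hi₁ ) × ⋯ × [ loₙ , hiₙ )
⟦_,_⟩ : ∀ {n} → Point n → Point n → Pred (Point n) 0ℓ
⟦ lo , hi ⟩ x = ∀ j → (lo j ≤ x j) × (x j < hi j)

unitCube : ∀ {n} → Pred (Point n) 0ℓ
unitCube = ⟦ (λ _ → 0ℝ) , (λ _ → 1ℝ) ⟩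

volume : ∀ {n} → Point n → Point n → ℝ
volume lo hi = product (λ j → hi j - lo j)

-- The exceptional set { x : ¬ P x } has Lebesgue outer measure zero: it is
-- covered by countably many boxes of arbitrarily small total volume.  The
-- covering condition is stated in contrapositive form.
AlmostEverywhere : ∀ {n} → Pred (Point n) 0ℓ → Set
AlmostEverywhere {n} P = ∀ ε → 0ℝ < ε →
  Σ[ lo ∈ (ℕ → Point n) ] Σ[ hi ∈ (ℕ → Point n) ]
    (∀ i j → lo i j ≤ hi i j) ×
    (∀ m → partialSum (λ i → volume (lo i) (hi i)) m ≤ ε) ×
    (∀ x → (∀ i → x ∉ ⟦ lo i , hi i ⟩) → x ∈ P)

------------------------------------------------------------------------
-- Well distributed sequences

-- B_{C,q}(η); its side is C / q^(1/n) = C (1/q)^(1/n).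
box : ∀ {n} .{{_ : NonZero n}} → ℝ → (q : ℕ) .{{_ : NonZero q}} → Point n → Pred (Point n) 0ℓ
box {n} C q η = ⟦ η , (λ j → η j + C * root n 1 q) ⟩

-- Sequences of points are indexed from 1; the value at 0 is irrelevant.
WellDistributed : ∀ {n} .{{_ : NonZero n}} → (ℕ → Point n) → Set
WellDistributed {n} ξ = Σ[ C ∈ ℝ ] (0ℝ < C) ×
  (∀ N → Σ[ q ∈ ℕ ] Σ[ q≢0 ∈ NonZero q ] (N ℕ.≤ q) ×
    (∀ η → η ∈ unitCube → box C q {{q≢0}} η ⊆ unitCube →
      ∃[ k ] (1 ℕ.≤ k) × (k ℕ.≤ q) × ξ k ∈ box C q {{q≢0}} η))

{-# OPTIONS --safe #-}
module Submission where

-- Write a_k(η) = k^(1/n) max_j ‖ξ_{j,k} - η_j‖.  Since a_k ≥ 0, it suffices to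
-- cover, for all N and J and with arbitrarily small total volume, the points η
-- of the unit cube for which a_k(η) > 1/(J+1) whenever k ≥ N; the countably many
-- exceptional sets N = J = j then receive the shares ε/2^(j+1) of the volume.
--
-- Call the cubes in [0,1)ⁿ of side 1/L with corners in (1/L)ℤⁿ the cells of level
-- L, and suppose that the exceptional set is already covered by some of
-- these cells.  For suitable large q the sequence is well distributed at scale
-- C/q^(1/n).  Choose a multiple M = Lm of L such that every cell of level M
-- contains N+1 disjoint boxes B_{C,q}, with m maximal up to a constant factor.  By
-- the pigeonhole principle each cell of level M contains some ξ_k with N ≤ k ≤ q,
-- and q ≤ (KM)ⁿ for a constant K that depends on C and N but not on L
-- ("lateHits").
-- Divide each such cell into rⁿ subcells, r = 3K(J+1).  On a subcell next to ξ_k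
-- one has a_k ≤ KM · 3/(Mr) = 1/(J+1), so this subcell may be discarded
-- ("hole-close").  Thus the covering set shrinks by the factor 1 - r⁻ⁿ
-- ("improve"), and as r does not change from one step to the next, iteration
-- makes its volume as small as desired ("sparseCover").  No density theorem is
-- needed.
--
-- Real numbers can be neither compared nor located exactly, which is met as
-- follows.  A subcell next to ξ_k is found up to an error of one subcell
-- ("locate").  For a point η outside all covering cells, an index k is searched
-- among the finitely many indices attached to the discarded cells, deciding for
-- each either a_k(η) < e or a_k(η) > 1/(J+1), where 1/(J+1) < e ("compare").
-- That η lies in some cell is only used to refute the failure of this search, so
-- that its double negation is enough ("¬¬cube").

open import Defs
open import Data.Nat.Base using (ℕ; NonZero) renaming (_≤_ to _≤ℕ_)
open import Relation.Unary using (_∈_)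

open import Data.Fin.Base as Fin using (Fin; toℕ; combine; fromℕ<)
import Data.Fin.Properties as Fin
open import Data.Integer.Base as ℤ using (+_)
import Data.Integer.Properties as ℤ
open import Data.List.Base as List
  using (List; []; _∷_; length; cartesianProductWith; allFin; concatMap; filter)
import Data.List.Properties as List
open import Data.List.Membership.Propositional using (lose) renaming (_∈_ to _∈ₗ_)
open import Data.List.Membership.Propositional.Properties
  using (∈-cartesianProductWith⁺; ∈-allFin; ∈-concatMap⁺; ∈-map⁺; ∈-filter⁺)
open import Data.List.Relation.Unary.All as All using (All; []; _∷_)
open import Data.List.Relation.Unary.Any using (here; there)
open import Data.Maybe.Base using (Maybe; just; nothing; maybe′)
open import Data.Nat.Base as ℕ using (zero; suc)
import Data.Nat.Properties as ℕ
open import Data.Nat.Tactic.RingSolver using () renaming (solve-∀ to solveℕ-∀)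
open import Data.Product.Base using (Σ-syntax; ∃-syntax; ∃₂; _×_; _,_; proj₁; proj₂)
open import Data.Rational.Base as ℚ using (ℚ; mkℚ; 0ℚ; 1ℚ; ↥_; ↧ₙ_)
import Data.Rational.Properties as ℚ
import Data.Rational.Unnormalised.Base as ℚᵘ
import Data.Rational.Unnormalised.Properties as ℚᵘ
open import Data.Sum.Base using (_⊎_; inj₁; inj₂)
open import Data.Vec.Base as Vec using (Vec; []; _∷_; lookup; zipWith; tabulate)
import Data.Vec.Properties as Vec
open import Data.Vec.Functional as Vector using (Vector)
open import Level using (0ℓ)
open import Relation.Binary.PropositionalEquality
open import Relation.Nullary using (¬_; ¬?; Dec; contradiction; yes; no)
open import Relation.Unary using (Pred; _∉_; _⊆_)
open import Tactic.RingSolver using (solve-∀)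

------------------------------------------------------------------------
-- Fractions of natural numbers

infix 8 _÷_

-- Opaque, so that the type checker does not normalise fractions.
opaque
  _÷_ : ℕ → (d : ℕ) → .{{NonZero d}} → ℚ
  a ÷ d = + a ℚ./ d

opaque
  unfolding _÷_

  toℚᵘ-÷ : ∀ a d → ℚ.toℚᵘ (a ÷ suc d) ℚᵘ.≃ ℚᵘ.mkℚᵘ (+ a) d
  toℚᵘ-÷ a d = ℚ.toℚᵘ-fromℚᵘ (ℚᵘ.mkℚᵘ (+ a) d)

÷-mono-≤ : ∀ a d b e .{{_ : NonZero d}} .{{_ : NonZero e}} →
           a ℕ.* e ℕ.≤ b ℕ.* d → a ÷ d ℚ.≤ b ÷ e
÷-mono-≤ a d@(suc d-1) b e@(suc e-1) h = ℚ.toℚᵘ-cancel-≤ (begin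
  ℚ.toℚᵘ (a ÷ d)       ≃⟨ toℚᵘ-÷ a d-1 ⟩
  ℚᵘ.mkℚᵘ (+ a) d-1    ≤⟨ ℚᵘ.*≤* (subst₂ ℤ._≤_ (ℤ.pos-* a e) (ℤ.pos-* b d) (ℤ.+≤+ h)) ⟩
  ℚᵘ.mkℚᵘ (+ b) e-1    ≃⟨ toℚᵘ-÷ b e-1 ⟨
  ℚ.toℚᵘ (b ÷ e)       ∎)
  where open ℚᵘ.≤-Reasoning

÷-mono-< : ∀ a d b e .{{_ : NonZero d}} .{{_ : NonZero e}} →
           a ℕ.* e ℕ.< b ℕ.* d → a ÷ d ℚ.< b ÷ e
÷-mono-< a d@(suc d-1) b e@(suc e-1) h = ℚ.toℚᵘ-cancel-< (begin-strict
  ℚ.toℚᵘ (a ÷ d)       ≃⟨ toℚᵘ-÷ a d-1 ⟩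
  ℚᵘ.mkℚᵘ (+ a) d-1    <⟨ ℚᵘ.*<* (subst₂ ℤ._<_ (ℤ.pos-* a e) (ℤ.pos-* b d) (ℤ.+<+ h)) ⟩
  ℚᵘ.mkℚᵘ (+ b) e-1    ≃⟨ toℚᵘ-÷ b e-1 ⟨
  ℚ.toℚᵘ (b ÷ e)       ∎)
  where open ℚᵘ.≤-Reasoning

÷-cong : ∀ {a b d e} .{{_ : NonZero d}} .{{_ : NonZero e}} → a ≡ b → d ≡ e → a ÷ d ≡ b ÷ e
÷-cong refl refl = refl

÷-monoˡ-≤ : ∀ {a b} d .{{_ : NonZero d}} → a ℕ.≤ b → a ÷ d ℚ.≤ b ÷ d
÷-monoˡ-≤ {a} {b} d a≤b = ÷-mono-≤ a d b d (ℕ.*-monoˡ-≤ d a≤b)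

÷-monoˡ-< : ∀ {a b} d .{{_ : NonZero d}} → a ℕ.< b → a ÷ d ℚ.< b ÷ d
÷-monoˡ-< {a} {b} d a<b = ÷-mono-< a d b d (ℕ.*-monoˡ-< d a<b)

÷-+ : ∀ a b d .{{_ : NonZero d}} → a ÷ d ℚ.+ b ÷ d ≡ (a ℕ.+ b) ÷ d
÷-+ a b d@(suc d-1) = ℚ.toℚᵘ-injective (begin
  ℚ.toℚᵘ (a ÷ d ℚ.+ b ÷ d)                          ≈⟨ ℚ.toℚᵘ-homo-+ (a ÷ d) (b ÷ d) ⟩
  ℚ.toℚᵘ (a ÷ d) ℚᵘ.+ ℚ.toℚᵘ (b ÷ d)                ≈⟨ ℚᵘ.+-cong (toℚᵘ-÷ a d-1) (toℚᵘ-÷ b d-1) ⟩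
  ℚᵘ.mkℚᵘ (+ a) d-1 ℚᵘ.+ ℚᵘ.mkℚᵘ (+ b) d-1          ≈⟨ ℚᵘ.*≡* cross ⟩
  ℚᵘ.mkℚᵘ (+ (a ℕ.+ b)) d-1                         ≈⟨ toℚᵘ-÷ (a ℕ.+ b) d-1 ⟨
  ℚ.toℚᵘ ((a ℕ.+ b) ÷ d)                            ∎)
  where
  open import Relation.Binary.Reasoning.Setoid ℚᵘ.≃-setoid
  cross : (+ a ℤ.* + d ℤ.+ + b ℤ.* + d) ℤ.* + d ≡ + (a ℕ.+ b) ℤ.* + (d ℕ.* d)
  cross = trans (cong (ℤ._* + d) (sym (ℤ.*-distribʳ-+ (+ d) (+ a) (+ b))))
    (trans (ℤ.*-assoc (+ a ℤ.+ + b) (+ d) (+ d))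
      (cong₂ ℤ._*_ (sym (ℤ.pos-+ a b)) (sym (ℤ.pos-* d d))))

÷-* : ∀ a b d e .{{_ : NonZero d}} .{{_ : NonZero e}} →
      a ÷ d ℚ.* b ÷ e ≡ ((a ℕ.* b) ÷ (d ℕ.* e)) {{ℕ.m*n≢0 d e}}
÷-* a b d@(suc d-1) e@(suc e-1) = ℚ.toℚᵘ-injective (begin
  ℚ.toℚᵘ (a ÷ d ℚ.* b ÷ e)                          ≈⟨ ℚ.toℚᵘ-homo-* (a ÷ d) (b ÷ e) ⟩
  ℚ.toℚᵘ (a ÷ d) ℚᵘ.* ℚ.toℚᵘ (b ÷ e)                ≈⟨ ℚᵘ.*-cong (toℚᵘ-÷ a d-1) (toℚᵘ-÷ b e-1) ⟩
  ℚᵘ.mkℚᵘ (+ a) d-1 ℚᵘ.* ℚᵘ.mkℚᵘ (+ b) e-1          ≈⟨ ℚᵘ.*≡* (cong (ℤ._* + (d ℕ.* e)) (sym (ℤ.pos-* a b))) ⟩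
  ℚᵘ.mkℚᵘ (+ (a ℕ.* b)) (ℕ.pred (d ℕ.* e))          ≈⟨ toℚᵘ-÷ (a ℕ.* b) (ℕ.pred (d ℕ.* e)) ⟨
  ℚ.toℚᵘ ((a ℕ.* b) ÷ (d ℕ.* e))                    ∎)
  where open import Relation.Binary.Reasoning.Setoid ℚᵘ.≃-setoid

opaque
  unfolding _÷_

  0÷1≡0 : 0 ÷ 1 ≡ 0ℚ
  0÷1≡0 = refl

  1÷1≡1 : 1 ÷ 1 ≡ 1ℚ
  1÷1≡1 = refl

0≤÷ : ∀ a d .{{_ : NonZero d}} → 0ℚ ℚ.≤ a ÷ d
0≤÷ a d = subst (ℚ._≤ a ÷ d) 0÷1≡0 (÷-mono-≤ 0 1 a d ℕ.z≤n)

0<1÷ : ∀ d .{{_ : NonZero d}} → 0ℚ ℚ.< 1 ÷ d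
0<1÷ d = subst (ℚ._< 1 ÷ d) 0÷1≡0 (÷-mono-< 0 1 1 d ℕ.z<s)

÷-nonNeg : ∀ a d .{{_ : NonZero d}} → ℚ.NonNegative (a ÷ d)
÷-nonNeg a d = ℚ.nonNegative (0≤÷ a d)

÷≤1 : ∀ {a d} .{{_ : NonZero d}} → a ℕ.≤ d → a ÷ d ℚ.≤ 1ℚ
÷≤1 {a} {d} a≤d = subst (a ÷ d ℚ.≤_) 1÷1≡1
  (÷-mono-≤ a d 1 1 (subst₂ ℕ._≤_ (sym (ℕ.*-identityʳ a)) (sym (ℕ.*-identityˡ d)) a≤d))

≤-∣↥∣ : ∀ p → p ℚ.≤ suc ℤ.∣ ↥ p ∣ ÷ 1
≤-∣↥∣ p@record{} = ℚ.toℚᵘ-cancel-≤ (begin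
  ℚ.toℚᵘ p                         ≤⟨ ℚᵘ.*≤* cross ⟩
  ℚᵘ.mkℚᵘ (+ suc ℤ.∣ ↥ p ∣) 0      ≃⟨ toℚᵘ-÷ (suc ℤ.∣ ↥ p ∣) 0 ⟨
  ℚ.toℚᵘ (suc ℤ.∣ ↥ p ∣ ÷ 1)       ∎)
  where
  open ℚᵘ.≤-Reasoning
  i≤∣i∣ : ∀ i → i ℤ.≤ + ℤ.∣ i ∣
  i≤∣i∣ (+ _)      = ℤ.≤-refl
  i≤∣i∣ ℤ.-[1+ _ ] = ℤ.-≤+
  cross : ↥ p ℤ.* + 1 ℤ.≤ + suc ℤ.∣ ↥ p ∣ ℤ.* + ↧ₙ p
  cross = subst₂ ℤ._≤_ (sym (ℤ.*-identityʳ (↥ p))) (ℤ.pos-* (suc ℤ.∣ ↥ p ∣) (↧ₙ p))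
    (ℤ.≤-trans (i≤∣i∣ (↥ p))
      (ℤ.+≤+ (ℕ.≤-trans (ℕ.n≤1+n ℤ.∣ ↥ p ∣) (ℕ.m≤m*n (suc ℤ.∣ ↥ p ∣) (↧ₙ p)))))

1÷↧ₙ-≤ : ∀ {p} → 0ℚ ℚ.< p → 1 ÷ ↧ₙ p ℚ.≤ p
1÷↧ₙ-≤ {mkℚ (+ zero) _ _}     0<p = contradiction (ℚ.positive 0<p) λ ()
1÷↧ₙ-≤ {mkℚ ℤ.-[1+ _ ] _ _}   0<p = contradiction (ℚ.positive 0<p) λ ()
1÷↧ₙ-≤ {p@(mkℚ (+ suc m) d-1 _)} 0<p = ℚ.toℚᵘ-cancel-≤ (begin
  ℚ.toℚᵘ (1 ÷ suc d-1)    ≃⟨ toℚᵘ-÷ 1 d-1 ⟩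
  ℚᵘ.mkℚᵘ (+ 1) d-1       ≤⟨ ℚᵘ.*≤* (ℤ.*-monoʳ-≤-nonNeg (+ suc d-1) {+ 1} {+ suc m} (ℤ.+≤+ (ℕ.s≤s ℕ.z≤n))) ⟩
  ℚ.toℚᵘ p                ∎)
  where open ℚᵘ.≤-Reasoning

------------------------------------------------------------------------
-- Approximations of reals

opaque
  unfolding _+_
  seq-+ : ∀ x y m → seq (x + y) m ≡ seq x m ℚ.+ seq y m
  seq-+ x y m = refl

opaque
  unfolding -_
  seq-neg : ∀ x m → seq (- x) m ≡ ℚ.- seq x m
  seq-neg x m = refl

opaque
  unfolding _⊔_
  seq-⊔ : ∀ x y m → seq (x ⊔ y) m ≡ seq x m ℚ.⊔ seq y m
  seq-⊔ x y m = refl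

opaque
  unfolding _*_
  seq-* : ∀ x y m → seq (x * y) m ≡ seq x m ℚ.* seq y m
  seq-* x y m = refl

opaque
  unfolding ‖_‖
  seq-‖‖ : ∀ x m → seq ‖ x ‖ m ≡ distℤ (seq x m)
  seq-‖‖ x m = refl

opaque
  unfolding root _÷_
  seq-root : ∀ n u v .{{_ : NonZero n}} .{{_ : NonZero v}} m →
             seq (root n u v) m ≡ rootFloor n u v (suc m) ÷ suc m
  seq-root n u v m = refl

seq-- : ∀ x y m → seq (x - y) m ≡ seq x m ℚ.- seq y m
seq-- x y m = trans (seq-+ x (- y) m) (cong (seq x m ℚ.+_) (seq-neg y m))

-- P holds at all sufficiently large indices.
Eventually : (ℕ → Set) → Set
Eventually P = ∃[ N ] ∀ m → N ℕ.≤ m → P m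

always : ∀ {P : ℕ → Set} → (∀ m → P m) → Eventually P
always p = 0 , λ m _ → p m

map-ev : ∀ {P Q : ℕ → Set} → (∀ m → P m → Q m) → Eventually P → Eventually Q
map-ev f (N , p) = N , λ m N≤m → f m (p m N≤m)

zip-ev : ∀ {P Q R : ℕ → Set} → (∀ m → P m → Q m → R m) →
         Eventually P → Eventually Q → Eventually R
zip-ev f (M , p) (N , q) = M ℕ.⊔ N , λ m h →
  f m (p m (ℕ.m⊔n≤o⇒m≤o M N h)) (q m (ℕ.m⊔n≤o⇒n≤o M N h))

ev⇒∃ : ∀ {P : ℕ → Set} → Eventually P → ∃[ m ] P m
ev⇒∃ (N , p) = N , p N ℕ.≤-refl

p≤p+q : ∀ p {q} → 0ℚ ℚ.≤ q → p ℚ.≤ p ℚ.+ q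
p≤p+q p {q} 0≤q = subst (ℚ._≤ p ℚ.+ q) (ℚ.+-identityʳ p) (ℚ.+-monoʳ-≤ p 0≤q)

p<p+q : ∀ p {q} → 0ℚ ℚ.< q → p ℚ.< p ℚ.+ q
p<p+q p {q} 0<q = subst (ℚ._< p ℚ.+ q) (ℚ.+-identityʳ p) (ℚ.+-monoʳ-< p 0<q)

<⇒0<- : ∀ {p q} → p ℚ.< q → 0ℚ ℚ.< q ℚ.- p
<⇒0<- {p} {q} p<q = subst (ℚ._< q ℚ.- p) (ℚ.+-inverseʳ p) (ℚ.+-monoˡ-< (ℚ.- p) p<q)

+-cancelʳ-≤ : ∀ r {p q} → p ℚ.+ r ℚ.≤ q ℚ.+ r → p ℚ.≤ q
+-cancelʳ-≤ r {p} {q} h = subst₂ ℚ._≤_ (cancel p r) (cancel q r) (ℚ.+-monoˡ-≤ (ℚ.- r) h)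
  where
  cancel : ∀ p r → (p ℚ.+ r) ℚ.- r ≡ p
  cancel = solve-∀ ℚ-ring

<⇒ev-≤ : ∀ {x y} → x < y → Eventually (λ m → seq x m ℚ.≤ seq y m)
<⇒ev-≤ {x} (ε , 0<ε , ev) =
  map-ev (λ m → ℚ.≤-trans (p≤p+q (seq x m) (ℚ.<⇒≤ 0<ε))) ev

<-respʳ-ev : ∀ {x y z} → x < y → Eventually (λ m → seq y m ℚ.≤ seq z m) → x < z
<-respʳ-ev (ε , 0<ε , ev) ev′ = ε , 0<ε , zip-ev (λ _ → ℚ.≤-trans) ev ev′

<-respˡ-ev : ∀ {x y z} → Eventually (λ m → seq x m ℚ.≤ seq y m) → y < z → x < z
<-respˡ-ev ev′ (ε , 0<ε , ev) =
  ε , 0<ε , zip-ev (λ _ h → ℚ.≤-trans (ℚ.+-monoˡ-≤ ε h)) ev′ ev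

<-trans : ∀ {x y z} → x < y → y < z → x < z
<-trans {x} {y} {z} x<y = <-respˡ-ev {x} {y} {z} (<⇒ev-≤ {x} {y} x<y)

<-irrefl : ∀ {x} → ¬ (x < x)
<-irrefl {x} (ε , 0<ε , ev) = let m , h = ev⇒∃ ev in
  ℚ.<-irrefl refl (ℚ.<-≤-trans (p<p+q (seq x m) 0<ε) h)

ev-≤⇒≤ : ∀ {x y} → Eventually (λ m → seq x m ℚ.≤ seq y m) → x ≤ y
ev-≤⇒≤ {x} {y} ev y<x = <-irrefl {y} (<-respʳ-ev {y} {x} {y} y<x ev)

fromℚ-mono-≤ : ∀ {p q} → p ℚ.≤ q → fromℚ p ≤ fromℚ q
fromℚ-mono-≤ {p} {q} p≤q = ev-≤⇒≤ {fromℚ p} {fromℚ q} (always λ _ → p≤q)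

fromℚ-mono-< : ∀ {p q} → p ℚ.< q → fromℚ p < fromℚ q
fromℚ-mono-< {p} {q} p<q = q ℚ.- p , <⇒0<- p<q , always λ _ →
  ℚ.≤-reflexive (y+[x-y]≡x q p)

<fromℚ-trans : ∀ {x p q} → x < fromℚ p → p ℚ.≤ q → x < fromℚ q
<fromℚ-trans {x} {p} {q} x<p p≤q = <-respʳ-ev {x} {fromℚ p} {fromℚ q} x<p (always λ _ → p≤q)

fromℚ≤-trans : ∀ {x p q} → p ℚ.≤ q → fromℚ q ≤ x → fromℚ p ≤ x
fromℚ≤-trans {x} p≤q q≤x x<p = q≤x (<fromℚ-trans {x} x<p p≤q)

-- Cotransitivity: every real is below the larger or above the smaller of two
-- distinct rationals.  All decisions about reals are instances of it.
compare : ∀ z {p q} → p ℚ.< q → z < fromℚ q ⊎ fromℚ p < z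
compare z {p} {q} p<q =
  let d , 0<d , 2d≡q-p = halve (q ℚ.- p) (<⇒0<- p<q)
      δ , 0<δ , 2δ≡d = halve d 0<d
      N , c = cauchy⁻ {seq z} (cauchy z) δ 0<δ
  in decide d δ N 0<δ 2δ≡d 2d≡q-p c (seq z N ℚ.≤? p ℚ.+ d)
  where
  open ℚ.≤-Reasoning
  decide : ∀ d δ N → 0ℚ ℚ.< δ → δ ℚ.+ δ ≡ d → d ℚ.+ d ≡ q ℚ.- p →
    (∀ m k → N ℕ.≤ m → N ℕ.≤ k → seq z m ℚ.< seq z k ℚ.+ δ) →
    Dec (seq z N ℚ.≤ p ℚ.+ d) → z < fromℚ q ⊎ fromℚ p < z
  decide d δ N 0<δ 2δ≡d 2d≡q-p c (yes h) = inj₁ (δ , 0<δ , N , λ m N≤m → begin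
    seq z m ℚ.+ δ              ≤⟨ ℚ.+-monoˡ-≤ δ (ℚ.<⇒≤ (c m N N≤m ℕ.≤-refl)) ⟩
    (seq z N ℚ.+ δ) ℚ.+ δ      ≡⟨ ℚ.+-assoc (seq z N) δ δ ⟩
    seq z N ℚ.+ (δ ℚ.+ δ)      ≡⟨ cong (seq z N ℚ.+_) 2δ≡d ⟩
    seq z N ℚ.+ d              ≤⟨ ℚ.+-monoˡ-≤ d h ⟩
    (p ℚ.+ d) ℚ.+ d            ≡⟨ ℚ.+-assoc p d d ⟩
    p ℚ.+ (d ℚ.+ d)            ≡⟨ cong (p ℚ.+_) 2d≡q-p ⟩
    p ℚ.+ (q ℚ.- p)            ≡⟨ y+[x-y]≡x q p ⟩
    q                          ∎)
  decide d δ N 0<δ 2δ≡d 2d≡q-p c (no h) = inj₂ (δ , 0<δ , N , λ m N≤m → +-cancelʳ-≤ δ (begin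
    (p ℚ.+ δ) ℚ.+ δ            ≡⟨ ℚ.+-assoc p δ δ ⟩
    p ℚ.+ (δ ℚ.+ δ)            ≡⟨ cong (p ℚ.+_) 2δ≡d ⟩
    p ℚ.+ d                    <⟨ ℚ.≰⇒> h ⟩
    seq z N                    <⟨ c N m ℕ.≤-refl N≤m ⟩
    seq z m ℚ.+ δ              ∎))

-- Constructively p ≤ z only bounds the approximations of z up to any
-- prescribed error.
fromℚ≤⇒ev : ∀ {z p} δ → 0ℚ ℚ.< δ → fromℚ p ≤ z → Eventually (λ m → p ℚ.≤ seq z m ℚ.+ δ)
fromℚ≤⇒ev {z} {p} δ 0<δ p≤z = decide (compare z p-δ<p)
  where
  p-δ<p : p ℚ.- δ ℚ.< p
  p-δ<p = <+⇒-< p δ (subst (p ℚ.<_) (ℚ.+-comm p δ) (p<p+q p 0<δ))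
  p-δ+δ≡p : ∀ p δ → (p ℚ.- δ) ℚ.+ δ ≡ p
  p-δ+δ≡p = solve-∀ ℚ-ring
  decide : z < fromℚ p ⊎ fromℚ (p ℚ.- δ) < z → Eventually (λ m → p ℚ.≤ seq z m ℚ.+ δ)
  decide (inj₁ z<p) = contradiction z<p p≤z
  decide (inj₂ h)   = map-ev
    (λ m h′ → subst (ℚ._≤ seq z m ℚ.+ δ) (p-δ+δ≡p p δ) (ℚ.+-monoˡ-≤ δ h′))
    (<⇒ev-≤ {fromℚ (p ℚ.- δ)} {z} h)

0<⇒rational : ∀ {x} → 0ℝ < x → ∃[ e ] (0ℚ ℚ.< e) × Eventually (λ m → e ℚ.≤ seq x m)
0<⇒rational {x} (e , 0<e , ev) =
  e , 0<e , map-ev (λ m → subst (ℚ._≤ seq x m) (ℚ.+-identityˡ e)) ev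

------------------------------------------------------------------------
-- Roots and distances

^-cancelˡ-≤ : ∀ n .{{_ : NonZero n}} {a b} → a ℕ.^ n ℕ.≤ b ℕ.^ n → a ℕ.≤ b
^-cancelˡ-≤ n h = ℕ.≮⇒≥ λ b<a → ℕ.<⇒≱ (ℕ.^-monoˡ-< n b<a) h

0≤root : ∀ n u v .{{_ : NonZero n}} .{{_ : NonZero v}} m → 0ℚ ℚ.≤ seq (root n u v) m
0≤root n u v m = subst (0ℚ ℚ.≤_) (sym (seq-root n u v m)) (0≤÷ (rootFloor n u v (suc m)) (suc m))

root-≤ : ∀ n k B .{{_ : NonZero n}} → k ℕ.≤ B ℕ.^ n → ∀ m → seq (root n k 1) m ℚ.≤ B ÷ 1
root-≤ n k B k≤Bⁿ m = subst (ℚ._≤ B ÷ 1) (sym (seq-root n k 1 m))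
  (÷-mono-≤ a (suc m) B 1 (subst (ℕ._≤ B ℕ.* suc m) (sym (ℕ.*-identityʳ a)) (^-cancelˡ-≤ n (begin
    a ℕ.^ n                     ≡⟨ ℕ.*-identityʳ (a ℕ.^ n) ⟨
    a ℕ.^ n ℕ.* 1               ≤⟨ rootSearch-≤ n k 1 (suc m) (k ℕ.* suc m) ⟩
    k ℕ.* suc m ℕ.^ n           ≤⟨ ℕ.*-monoˡ-≤ (suc m ℕ.^ n) k≤Bⁿ ⟩
    B ℕ.^ n ℕ.* suc m ℕ.^ n     ≡⟨ ^-distrib-* B (suc m) n ⟩
    (B ℕ.* suc m) ℕ.^ n         ∎))))
  where
  open ℕ.≤-Reasoning
  a = rootFloor n k 1 (suc m)

root⁻¹-≤ : ∀ n q B .{{_ : NonZero n}} .{{_ : NonZero q}} .{{_ : NonZero B}} →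
           B ℕ.^ n ℕ.≤ q → ∀ m → seq (root n 1 q) m ℚ.≤ 1 ÷ B
root⁻¹-≤ n q B Bⁿ≤q m = subst (ℚ._≤ 1 ÷ B) (sym (seq-root n 1 q m))
  (÷-mono-≤ a (suc m) 1 B (subst (a ℕ.* B ℕ.≤_) (sym (ℕ.*-identityˡ (suc m))) (^-cancelˡ-≤ n (begin
    (a ℕ.* B) ℕ.^ n             ≡⟨ ^-distrib-* a B n ⟨
    a ℕ.^ n ℕ.* B ℕ.^ n         ≤⟨ ℕ.*-monoʳ-≤ (a ℕ.^ n) Bⁿ≤q ⟩
    a ℕ.^ n ℕ.* q               ≤⟨ rootSearch-≤ n 1 q (suc m) (1 ℕ.* suc m) ⟩
    1 ℕ.* suc m ℕ.^ n           ≡⟨ ℕ.*-identityˡ (suc m ℕ.^ n) ⟩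
    suc m ℕ.^ n                 ∎))))
  where
  open ℕ.≤-Reasoning
  a = rootFloor n 1 q (suc m)

distℤ≤∣∣ : ∀ p → distℤ p ℚ.≤ ℚ.∣ p ∣
distℤ≤∣∣ p = subst (λ z → distℤ p ℚ.≤ ℚ.∣ z ∣) (ℚ.+-identityʳ p) (distℤ-≤ p (+ 0))

0≤distℤ : ∀ p → 0ℚ ℚ.≤ distℤ p
0≤distℤ p = let a , e = distℤ-attained p in
  subst (0ℚ ℚ.≤_) (sym e) (ℚ.0≤∣p∣ (p ℚ.- ℤ→ℚ a))

∣-∣≤⁺ : ∀ p q {r} → p ℚ.≤ q ℚ.+ r → q ℚ.≤ p ℚ.+ r → ℚ.∣ p ℚ.- q ∣ ℚ.≤ r
∣-∣≤⁺ p q {r} h₁ h₂ with ℚ.∣p∣≡p∨∣p∣≡-p (p ℚ.- q)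
... | inj₁ e = subst (ℚ._≤ r) (sym e) (subst (p ℚ.- q ℚ.≤_) ([y+ε]-y≡ε q r) (ℚ.+-monoˡ-≤ (ℚ.- q) h₁))
... | inj₂ e = subst (ℚ._≤ r) (sym (trans e (-[x-y]≡y-x p q)))
                 (subst (q ℚ.- p ℚ.≤_) ([y+ε]-y≡ε p r) (ℚ.+-monoˡ-≤ (ℚ.- p) h₂))

maximum-ev-≤ : ∀ {n} .{{_ : NonZero n}} (f : Vector ℝ n) {p} →
  (∀ j → Eventually (λ m → seq (f j) m ℚ.≤ p)) → Eventually (λ m → seq (maximum f) m ℚ.≤ p)
maximum-ev-≤ {suc zero}    f h = h Fin.zero
maximum-ev-≤ {suc (suc n)} f {p} h = zip-ev
  (λ m h₁ h₂ → subst (ℚ._≤ p) (sym (seq-⊔ (f Fin.zero) (maximum (Vector.tail f)) m)) (ℚ.⊔-lub h₁ h₂))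
  (h Fin.zero) (maximum-ev-≤ (Vector.tail f) λ j → h (Fin.suc j))

0≤maximum : ∀ {n} .{{_ : NonZero n}} (f : Vector ℝ n) m →
  (∀ j → 0ℚ ℚ.≤ seq (f j) m) → 0ℚ ℚ.≤ seq (maximum f) m
0≤maximum {suc zero}    f m h = h Fin.zero
0≤maximum {suc (suc n)} f m h = subst (0ℚ ℚ.≤_) (sym (seq-⊔ (f Fin.zero) (maximum (Vector.tail f)) m))
  (ℚ.≤-trans (h Fin.zero) (ℚ.p≤p⊔q (seq (f Fin.zero) m) _))

-- k^(1/n) max_j ‖y_j - x_j‖; for y = ξ_k this is the k-th term of the sequence
-- whose lower limit is studied.
scaledDistance : ∀ {n} .{{_ : NonZero n}} → ℕ → Point n → Point n → ℝ
scaledDistance {n} k y x = root n k 1 * maximum (λ j → ‖ y j - x j ‖)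

0≤scaledDistance : ∀ {n} .{{_ : NonZero n}} k (y x : Point n) m → 0ℚ ℚ.≤ seq (scaledDistance k y x) m
0≤scaledDistance {n} k y x m = subst (0ℚ ℚ.≤_) (sym (seq-* (root n k 1) (maximum dist) m))
  (ℚ.nonNegative⁻¹ (ρ ℚ.* μ) {{ℚ.nonNeg*nonNeg⇒nonNeg ρ {{ℚ.nonNegative (0≤root n k 1 m)}}
    μ {{ℚ.nonNegative (0≤maximum dist m λ j →
      subst (0ℚ ℚ.≤_) (sym (seq-‖‖ (y j - x j) m)) (0≤distℤ (seq (y j - x j) m)))}}}})
  where
  dist = λ j → ‖ y j - x j ‖
  ρ = seq (root n k 1) m
  μ = seq (maximum dist) m

scaledDistance-ev-≤ : ∀ {n} .{{_ : NonZero n}} k B a d .{{_ : NonZero d}} (y x : Point n) →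
  k ℕ.≤ B ℕ.^ n →
  (∀ j → Eventually (λ m → ℚ.∣ seq (y j) m ℚ.- seq (x j) m ∣ ℚ.≤ a ÷ d)) →
  Eventually (λ m → seq (scaledDistance k y x) m ℚ.≤ (B ℕ.* a) ÷ d)
scaledDistance-ev-≤ {n} k B a d y x k≤Bⁿ h = map-ev step
  (maximum-ev-≤ dist λ j → map-ev (λ m h′ → subst (ℚ._≤ a ÷ d)
    (sym (trans (seq-‖‖ (y j - x j) m) (cong distℤ (seq-- (y j) (x j) m))))
    (ℚ.≤-trans (distℤ≤∣∣ (seq (y j) m ℚ.- seq (x j) m)) h′)) (h j))
  where
  open ℚ.≤-Reasoning
  dist = λ j → ‖ y j - x j ‖
  step : ∀ m → seq (maximum dist) m ℚ.≤ a ÷ d → seq (scaledDistance k y x) m ℚ.≤ (B ℕ.* a) ÷ d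
  step m h′ = begin
    seq (scaledDistance k y x) m                 ≡⟨ seq-* (root n k 1) (maximum dist) m ⟩
    seq (root n k 1) m ℚ.* seq (maximum dist) m  ≤⟨ ℚ.*-monoˡ-≤-nonNeg (seq (root n k 1) m) {{ℚ.nonNegative (0≤root n k 1 m)}} h′ ⟩
    seq (root n k 1) m ℚ.* a ÷ d                 ≤⟨ ℚ.*-monoʳ-≤-nonNeg (a ÷ d) {{÷-nonNeg a d}} (root-≤ n k B k≤Bⁿ m) ⟩
    B ÷ 1 ℚ.* a ÷ d                              ≡⟨ ÷-* B a 1 d ⟩
    ((B ℕ.* a) ÷ (1 ℕ.* d)) {{ℕ.m*n≢0 1 d}}      ≡⟨ ÷-cong {{ℕ.m*n≢0 1 d}} refl (ℕ.*-identityˡ d) ⟩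
    (B ℕ.* a) ÷ d                                ∎

------------------------------------------------------------------------
-- Grids of cubes

-- [ a / L , (a + 1) / L )
interval : ∀ {L} .{{_ : NonZero L}} → Fin L → Pred ℝ 0ℓ
interval {L} a z = (fromℚ (toℕ a ÷ L) ≤ z) × (z < fromℚ (suc (toℕ a) ÷ L))

-- A cell of level L, given by the integer coordinates of its lower corner in
-- units of 1 / L; having them in Fin L keeps the cell inside the unit cube.
Cell : ℕ → ℕ → Set
Cell n L = Vec (Fin L) n

lower upper : ∀ {n L} .{{_ : NonZero L}} → Cell n L → Point n
lower {L = L} c j = fromℚ (toℕ (lookup c j) ÷ L)
upper {L = L} c j = fromℚ (suc (toℕ (lookup c j)) ÷ L)

cube : ∀ {n L} .{{_ : NonZero L}} → Cell n L → Pred (Point n) 0ℓ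
cube c = ⟦ lower c , upper c ⟩

-- The cell at position b in the division of the cell a into mⁿ parts.
subcell : ∀ {n L m} → Cell n L → Cell n m → Cell n (L ℕ.* m)
subcell a b = zipWith combine a b

subcell-surjective : ∀ {n} L m (c : Cell n (L ℕ.* m)) →
  ∃₂ λ (a : Cell n L) (b : Cell n m) → subcell a b ≡ c
subcell-surjective L m []      = [] , [] , refl
subcell-surjective L m (i ∷ c) =
  let a , b , ab≡i = Fin.combine-surjective {L} {m} i
      as , bs , eq = subcell-surjective L m c
  in a ∷ as , b ∷ bs , cong₂ _∷_ ab≡i eq

interval-combine-⊆ : ∀ {L m} .{{_ : NonZero L}} .{{_ : NonZero m}} (a : Fin L) (b : Fin m) {z} →
  interval {{ℕ.m*n≢0 L m}} (combine a b) z → interval a z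
interval-combine-⊆ {L} {m} a b {z} (lo , hi) =
  fromℚ≤-trans {z} (÷-mono-≤ (toℕ a) L (toℕ (combine a b)) (L ℕ.* m) (begin
    toℕ a ℕ.* (L ℕ.* m)             ≡⟨ arrange (toℕ a) L m ⟩
    (m ℕ.* toℕ a) ℕ.* L             ≤⟨ ℕ.*-monoˡ-≤ L (ℕ.m≤m+n (m ℕ.* toℕ a) (toℕ b)) ⟩
    (m ℕ.* toℕ a ℕ.+ toℕ b) ℕ.* L   ≡⟨ cong (ℕ._* L) (Fin.toℕ-combine a b) ⟨
    toℕ (combine a b) ℕ.* L         ∎)) lo ,
  <fromℚ-trans {z} hi (÷-mono-≤ (suc (toℕ (combine a b))) (L ℕ.* m) (suc (toℕ a)) L (begin
    suc (toℕ (combine a b)) ℕ.* L        ≡⟨ cong (λ u → suc u ℕ.* L) (Fin.toℕ-combine a b) ⟩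
    suc (m ℕ.* toℕ a ℕ.+ toℕ b) ℕ.* L    ≡⟨ cong (ℕ._* L) (ℕ.+-suc (m ℕ.* toℕ a) (toℕ b)) ⟨
    (m ℕ.* toℕ a ℕ.+ suc (toℕ b)) ℕ.* L  ≤⟨ ℕ.*-monoˡ-≤ L (ℕ.+-monoʳ-≤ (m ℕ.* toℕ a) (Fin.toℕ<n b)) ⟩
    (m ℕ.* toℕ a ℕ.+ m) ℕ.* L            ≡⟨ arrange′ (toℕ a) L m ⟩
    suc (toℕ a) ℕ.* (L ℕ.* m)            ∎))
  where
  open ℕ.≤-Reasoning
  instance
    Lm≢0 : NonZero (L ℕ.* m)
    Lm≢0 = ℕ.m*n≢0 L m
  arrange : ∀ a L m → a ℕ.* (L ℕ.* m) ≡ (m ℕ.* a) ℕ.* L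
  arrange = solveℕ-∀
  arrange′ : ∀ a L m → (m ℕ.* a ℕ.+ m) ℕ.* L ≡ suc a ℕ.* (L ℕ.* m)
  arrange′ = solveℕ-∀

cube-subcell-⊆ : ∀ {n L m} .{{_ : NonZero L}} .{{_ : NonZero m}} (c : Cell n L) (d : Cell n m) →
  cube {{ℕ.m*n≢0 L m}} (subcell c d) ⊆ cube c
cube-subcell-⊆ {L = L} {m} c d {x} x∈ j = interval-combine-⊆ (lookup c j) (lookup d j) {x j}
  (subst (λ u → interval {{ℕ.m*n≢0 L m}} u (x j)) (Vec.lookup-zipWith combine j c d) (x∈ j))

interval-⊆-unit : ∀ {L} .{{_ : NonZero L}} (a : Fin L) {z} → interval a z → (0ℝ ≤ z) × (z < 1ℝ)
interval-⊆-unit {L} a {z} (lo , hi) =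
  fromℚ≤-trans {z} (0≤÷ (toℕ a) L) lo , <fromℚ-trans {z} hi (÷≤1 (Fin.toℕ<n a))

cube-⊆-unitCube : ∀ {n L} .{{_ : NonZero L}} (c : Cell n L) → cube c ⊆ unitCube
cube-⊆-unitCube c {x} x∈ j = interval-⊆-unit (lookup c j) {x j} (x∈ j)

lower∈cube : ∀ {n L} .{{_ : NonZero L}} (c : Cell n L) → lower c ∈ cube c
lower∈cube {L = L} c j =
  fromℚ-mono-≤ ℚ.≤-refl , fromℚ-mono-< (÷-monoˡ-< L (ℕ.n<1+n (toℕ (lookup c j))))

lower≤upper : ∀ {n L} .{{_ : NonZero L}} (c : Cell n L) j → lower c j ≤ upper c j
lower≤upper {L = L} c j = fromℚ-mono-≤ (÷-monoˡ-≤ L (ℕ.n≤1+n (toℕ (lookup c j))))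

-- The interval of the grid containing a given real is not computable, hence
-- the double negation.
¬¬interval : ∀ L .{{_ : NonZero L}} z → 0ℝ ≤ z → z < 1ℝ → ¬ ¬ (∃[ a ] interval {L} a z)
¬¬interval L z 0≤z z<1 none = search L ℕ.≤-refl
  (<fromℚ-trans {z} z<1 (subst (ℚ._≤ L ÷ L) 1÷1≡1
    (÷-mono-≤ 1 1 L L (ℕ.≤-reflexive (ℕ.*-comm 1 L)))))
  where
  search : ∀ b → b ℕ.≤ L → ¬ (z < fromℚ (b ÷ L))
  search zero    _   z<0 = 0≤z (<fromℚ-trans {z} z<0
    (subst (0 ÷ L ℚ.≤_) 0÷1≡0 (÷-mono-≤ 0 L 0 1 ℕ.z≤n)))
  search (suc b) b<L z<  = none (fromℕ< b<L ,
    subst (λ u → (fromℚ (u ÷ L) ≤ z) × (z < fromℚ (suc u ÷ L)))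
      (sym (Fin.toℕ-fromℕ< b<L)) (search b (ℕ.<⇒≤ b<L) , z<))

¬¬-choice : ∀ n {A : Set} {P : Fin n → A → Set} →
  (∀ j → ¬ ¬ (∃[ a ] P j a)) → ¬ ¬ (Σ[ c ∈ Vec A n ] ∀ j → P j (lookup c j))
¬¬-choice zero    h k = k ([] , λ ())
¬¬-choice (suc n) h k = h Fin.zero λ (a , pa) → ¬¬-choice n (λ j → h (Fin.suc j))
  λ (c , pc) → k (a ∷ c , λ where Fin.zero → pa ; (Fin.suc j) → pc j)

¬¬cube : ∀ {n} L .{{_ : NonZero L}} (x : Point n) → x ∈ unitCube → ¬ ¬ (Σ[ c ∈ Cell n L ] x ∈ cube c)
¬¬cube {n} L x x∈ = ¬¬-choice n λ j → ¬¬interval L (x j) (proj₁ (x∈ j)) (proj₂ (x∈ j))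

-- [ u / W , (u + 2) / W ).  A real can be located in one of these overlapping
-- intervals.
doubleInterval : ∀ {W} .{{_ : NonZero W}} → Fin W → Pred ℝ 0ℓ
doubleInterval {W} u y = (fromℚ (toℕ u ÷ W) ≤ y) × (y < fromℚ ((2 ℕ.+ toℕ u) ÷ W))

-- Descending search: while y < (u + 2) / W is known, compare y with u / W and
-- (u + 1) / W.
locate : ∀ {M} r .{{_ : NonZero M}} .{{_ : NonZero r}} (a : Fin M) y → interval a y →
  Σ[ i ∈ Fin r ] doubleInterval {{ℕ.m*n≢0 M r}} (combine a i) y
locate {M} r@(suc r-1) a y (lo , hi) = search r-1 ℕ.≤-refl
  (<fromℚ-trans {y} hi (÷-mono-≤ (suc (toℕ a)) M (2 ℕ.+ (r ℕ.* toℕ a ℕ.+ r-1)) W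
    (subst (ℕ._≤ (2 ℕ.+ (r ℕ.* toℕ a ℕ.+ r-1)) ℕ.* M) (arrange (toℕ a) M r-1)
      (ℕ.*-monoˡ-≤ M (ℕ.n≤1+n (suc (r ℕ.* toℕ a ℕ.+ r-1)))))))
  where
  W = M ℕ.* r
  instance
    W≢0 : NonZero W
    W≢0 = ℕ.m*n≢0 M r
  arrange : ∀ a M k → suc (suc k ℕ.* a ℕ.+ k) ℕ.* M ≡ suc a ℕ.* (M ℕ.* suc k)
  arrange = solveℕ-∀
  arrange₀ : ∀ a M r → (r ℕ.* a ℕ.+ 0) ℕ.* M ≡ a ℕ.* (M ℕ.* r)
  arrange₀ = solveℕ-∀
  Found : ℕ → Set
  Found u = (fromℚ (u ÷ W) ≤ y) × (y < fromℚ ((2 ℕ.+ u) ÷ W))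
  found : ∀ {i} (i<r : i ℕ.< r) → Found (r ℕ.* toℕ a ℕ.+ i) →
          Σ[ i ∈ Fin r ] doubleInterval (combine a i) y
  found i<r f = fromℕ< i<r , subst Found (sym (trans (Fin.toℕ-combine a (fromℕ< i<r))
    (cong (r ℕ.* toℕ a ℕ.+_) (Fin.toℕ-fromℕ< i<r)))) f
  search : ∀ i → i ℕ.< r → y < fromℚ ((2 ℕ.+ (r ℕ.* toℕ a ℕ.+ i)) ÷ W) →
           Σ[ i ∈ Fin r ] doubleInterval (combine a i) y
  search zero    i<r y< = found i<r (fromℚ≤-trans {y}
    (÷-mono-≤ (r ℕ.* toℕ a ℕ.+ 0) W (toℕ a) M (ℕ.≤-reflexive (arrange₀ (toℕ a) M r))) lo , y<)
  search (suc i) i<r y< = decide (compare y (÷-monoˡ-< W (ℕ.n<1+n u)))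
    where
    u = r ℕ.* toℕ a ℕ.+ suc i
    decide : y < fromℚ (suc u ÷ W) ⊎ fromℚ (u ÷ W) < y →
             Σ[ i ∈ Fin r ] doubleInterval (combine a i) y
    decide (inj₁ y<′) = search i (ℕ.<⇒≤ i<r)
      (subst (λ v → y < fromℚ (suc v ÷ W)) (ℕ.+-suc (r ℕ.* toℕ a) i) y<′)
    decide (inj₂ u<y) = found i<r ((λ y<u → <-irrefl {y} (<-trans {y} {fromℚ (u ÷ W)} {y} y<u u<y)) , y<)

interval-close : ∀ {W} .{{_ : NonZero W}} (u : Fin W) {x y} → interval u x → doubleInterval u y →
  Eventually (λ m → ℚ.∣ seq y m ℚ.- seq x m ∣ ℚ.≤ 3 ÷ W)
interval-close {W} u {x} {y} (lx , ux) (ly , uy) = zip-ev (λ m (h₁ , h₂) (h₃ , h₄) →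
    ∣-∣≤⁺ (seq y m) (seq x m) (y≤x+ m h₁ h₄) (x≤y+ m h₂ h₃))
  (zip-ev (λ _ → _,_) (fromℚ≤⇒ev {x} δ 0<δ lx) (<⇒ev-≤ {x} {fromℚ (suc (toℕ u) ÷ W)} ux))
  (zip-ev (λ _ → _,_) (fromℚ≤⇒ev {y} δ 0<δ ly) (<⇒ev-≤ {y} {fromℚ ((2 ℕ.+ toℕ u) ÷ W)} uy))
  where
  open ℚ.≤-Reasoning
  δ = 1 ÷ W
  0<δ = 0<1÷ W
  y≤x+ : ∀ m → toℕ u ÷ W ℚ.≤ seq x m ℚ.+ δ → seq y m ℚ.≤ (2 ℕ.+ toℕ u) ÷ W →
         seq y m ℚ.≤ seq x m ℚ.+ 3 ÷ W
  y≤x+ m h₁ h₄ = begin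
    seq y m                              ≤⟨ h₄ ⟩
    (2 ℕ.+ toℕ u) ÷ W                    ≡⟨ cong (_÷ W) (ℕ.+-comm 2 (toℕ u)) ⟩
    (toℕ u ℕ.+ 2) ÷ W                    ≡⟨ ÷-+ (toℕ u) 2 W ⟨
    toℕ u ÷ W ℚ.+ 2 ÷ W                  ≤⟨ ℚ.+-monoˡ-≤ (2 ÷ W) h₁ ⟩
    (seq x m ℚ.+ 1 ÷ W) ℚ.+ 2 ÷ W        ≡⟨ ℚ.+-assoc (seq x m) (1 ÷ W) (2 ÷ W) ⟩
    seq x m ℚ.+ (1 ÷ W ℚ.+ 2 ÷ W)        ≡⟨ cong (seq x m ℚ.+_) (÷-+ 1 2 W) ⟩
    seq x m ℚ.+ 3 ÷ W                    ∎
  x≤y+ : ∀ m → seq x m ℚ.≤ suc (toℕ u) ÷ W → toℕ u ÷ W ℚ.≤ seq y m ℚ.+ δ →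
         seq x m ℚ.≤ seq y m ℚ.+ 3 ÷ W
  x≤y+ m h₂ h₃ = begin
    seq x m                              ≤⟨ h₂ ⟩
    suc (toℕ u) ÷ W                      ≡⟨ cong (_÷ W) (ℕ.+-comm 1 (toℕ u)) ⟩
    (toℕ u ℕ.+ 1) ÷ W                    ≡⟨ ÷-+ (toℕ u) 1 W ⟨
    toℕ u ÷ W ℚ.+ 1 ÷ W                  ≤⟨ ℚ.+-monoˡ-≤ (1 ÷ W) h₃ ⟩
    (seq y m ℚ.+ 1 ÷ W) ℚ.+ 1 ÷ W        ≡⟨ ℚ.+-assoc (seq y m) (1 ÷ W) (1 ÷ W) ⟩
    seq y m ℚ.+ (1 ÷ W ℚ.+ 1 ÷ W)        ≡⟨ cong (seq y m ℚ.+_) (÷-+ 1 1 W) ⟩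
    seq y m ℚ.+ 2 ÷ W                    ≤⟨ ℚ.+-monoʳ-≤ (seq y m) (÷-monoˡ-≤ {2} {3} W (ℕ.n≤1+n 2)) ⟩
    seq y m ℚ.+ 3 ÷ W                    ∎

------------------------------------------------------------------------
-- Cells are visited late

natBound : ∀ x → ∃[ c ] Eventually (λ m → seq x m ℚ.≤ suc c ÷ 1)
natBound x = let B , _ , ev = bounded x in ℤ.∣ ↥ B ∣ , map-ev
  (λ m h → ℚ.≤-trans (p≤∣p∣ (seq x m)) (ℚ.≤-trans h (≤-∣↥∣ B))) ev

-- Every q ≥ Bⁿ lies within a factor 2ⁿ of the n-th power of a multiple of B.
scale : ∀ n B q .{{B≢0 : NonZero B}} .{{n≢0 : NonZero n}} → B ℕ.^ n ℕ.≤ q → Σ[ m ∈ ℕ ] NonZero m ×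
  ((m ℕ.* B) ℕ.^ n ℕ.≤ q) × (q ℕ.≤ ((m ℕ.+ m) ℕ.* B) ℕ.^ n)
-- m = ⌊ q^(1/n) / B ⌋
scale n B q {{_}} {{n≢0}} Bⁿ≤q = bounds (rootFloor n q (B ℕ.^ n) 1)
  (rootSearch-≤ n q (B ℕ.^ n) 1 (q ℕ.* 1)) (<-rootFloor n q (B ℕ.^ n) 1 {{n≢0}} {{ℕ.m^n≢0 B n}})
  where
  q*1ⁿ≡q : q ℕ.* 1 ℕ.^ n ≡ q
  q*1ⁿ≡q = trans (cong (q ℕ.*_) (ℕ.^-zeroˡ n)) (ℕ.*-identityʳ q)
  bounds : ∀ m → m ℕ.^ n ℕ.* B ℕ.^ n ℕ.≤ q ℕ.* 1 ℕ.^ n →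
    q ℕ.* 1 ℕ.^ n ℕ.< suc m ℕ.^ n ℕ.* B ℕ.^ n → Σ[ m ∈ ℕ ] NonZero m ×
    ((m ℕ.* B) ℕ.^ n ℕ.≤ q) × (q ℕ.≤ ((m ℕ.+ m) ℕ.* B) ℕ.^ n)
  bounds zero    _  hi = contradiction
    (subst₂ ℕ._<_ q*1ⁿ≡q (trans (cong (ℕ._* B ℕ.^ n) (ℕ.^-zeroˡ n)) (ℕ.*-identityˡ (B ℕ.^ n))) hi)
    (ℕ.≤⇒≯ Bⁿ≤q)
  bounds m@(suc k) lo hi = m , _ , subst₂ ℕ._≤_ (^-distrib-* m B n) q*1ⁿ≡q lo ,
    ℕ.≤-trans (ℕ.<⇒≤ (subst₂ ℕ._<_ q*1ⁿ≡q (^-distrib-* (suc m) B n) hi))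
      (ℕ.^-monoˡ-≤ n (ℕ.*-monoˡ-≤ B (ℕ.+-monoˡ-≤ m (ℕ.s≤s (ℕ.z≤n {k})))))

firstAxis : ∀ {n} .{{_ : NonZero n}} → Fin n
firstAxis {suc _} = Fin.zero

-- The number of parts into which the sides of a cube are divided before one of
-- its subcubes is discarded: 3 bounds the distance from a located point in
-- units of the new side, and K / (side of the cube) bounds the n-th roots.
fineness : (K J : ℕ) → ℕ
fineness K J = 3 ℕ.* (K ℕ.* suc J)

fineness≢0 : ∀ K J .{{_ : NonZero K}} → NonZero (fineness K J)
fineness≢0 K J = ℕ.m*n≢0 3 (K ℕ.* suc J) {{_}} {{ℕ.m*n≢0 K (suc J)}}

module _ {n : ℕ} .{{_ : NonZero n}} where

  -- The side C / q^(1/n) of the box is at most 1 / P when (c P)ⁿ ≤ q and C ≤ c.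
  box⊆cube : ∀ (C : ℝ) (c q P : ℕ) .{{_ : NonZero c}} .{{_ : NonZero q}} .{{_ : NonZero P}} →
    Eventually (λ m → seq C m ℚ.≤ c ÷ 1) → (c ℕ.* P) ℕ.^ n ℕ.≤ q →
    (a : Cell n P) → box C q (lower a) ⊆ cube a
  box⊆cube C c q P C≤c cPⁿ≤q a {x} x∈ j = proj₁ (x∈ j) ,
    <-respʳ-ev {x j} {lower a j + C * root n 1 q} {upper a j} (proj₂ (x∈ j)) (map-ev side C≤c)
    where
    open ℚ.≤-Reasoning
    instance
      cP≢0 : NonZero (c ℕ.* P)
      cP≢0 = ℕ.m*n≢0 c P
    u = toℕ (lookup a j)
    ρ = seq (root n 1 q)
    cross : ∀ c P → c ℕ.* P ≡ 1 ℕ.* (1 ℕ.* (c ℕ.* P))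
    cross = solveℕ-∀
    side : ∀ m → seq C m ℚ.≤ c ÷ 1 → seq (lower a j + C * root n 1 q) m ℚ.≤ suc u ÷ P
    side m h = begin
      seq (lower a j + C * root n 1 q) m          ≡⟨ seq-+ (lower a j) (C * root n 1 q) m ⟩
      u ÷ P ℚ.+ seq (C * root n 1 q) m            ≡⟨ cong (u ÷ P ℚ.+_) (seq-* C (root n 1 q) m) ⟩
      u ÷ P ℚ.+ seq C m ℚ.* ρ m                   ≤⟨ ℚ.+-monoʳ-≤ (u ÷ P) (ℚ.*-monoʳ-≤-nonNeg (ρ m) {{ℚ.nonNegative (0≤root n 1 q m)}} h) ⟩
      u ÷ P ℚ.+ c ÷ 1 ℚ.* ρ m                     ≤⟨ ℚ.+-monoʳ-≤ (u ÷ P) (ℚ.*-monoˡ-≤-nonNeg (c ÷ 1) {{÷-nonNeg c 1}} (root⁻¹-≤ n q (c ℕ.* P) cPⁿ≤q m)) ⟩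
      u ÷ P ℚ.+ c ÷ 1 ℚ.* 1 ÷ (c ℕ.* P)           ≡⟨ cong (u ÷ P ℚ.+_) (÷-* c 1 1 (c ℕ.* P)) ⟩
      u ÷ P ℚ.+ ((c ℕ.* 1) ÷ (1 ℕ.* (c ℕ.* P))) {{ℕ.m*n≢0 1 (c ℕ.* P)}}
        ≤⟨ ℚ.+-monoʳ-≤ (u ÷ P) (÷-mono-≤ (c ℕ.* 1) (1 ℕ.* (c ℕ.* P)) 1 P {{ℕ.m*n≢0 1 (c ℕ.* P)}}
             (ℕ.≤-reflexive (trans (cong (ℕ._* P) (ℕ.*-identityʳ c)) (cross c P)))) ⟩
      u ÷ P ℚ.+ 1 ÷ P                             ≡⟨ ÷-+ u 1 P ⟩
      (u ℕ.+ 1) ÷ P                               ≡⟨ cong (_÷ P) (ℕ.+-comm u 1) ⟩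
      suc u ÷ P                                   ∎

  -- The N + 1 subcells on the diagonal of a cell are disjoint.  If each of them is
  -- visited, the visits take place at N + 1 distinct times, so one of these times
  -- is at least N.
  late-visit : ∀ (y : ℕ → Point n) M N q .{{_ : NonZero M}} →
    ((b : Cell n (M ℕ.* suc N)) → ∃[ k ] (k ℕ.≤ q) × y k ∈ cube {{ℕ.m*n≢0 M (suc N)}} b) →
    (a : Cell n M) → ∃[ k ] (N ℕ.≤ k) × (k ℕ.≤ q) × y k ∈ cube a
  late-visit y M N q hit a = decide (Fin.any? λ i → N ℕ.≤? k i)
    where
    W = M ℕ.* suc N
    instance
      W≢0 : NonZero W
      W≢0 = ℕ.m*n≢0 M (suc N)
    j₀ = firstAxis {n}
    child : Fin (suc N) → Cell n (M ℕ.* suc N)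
    child i = subcell a (Vec.replicate n i)
    k : Fin (suc N) → ℕ
    k i = proj₁ (hit (child i))
    k∈ : ∀ i → y (k i) ∈ cube (child i)
    k∈ i = proj₂ (proj₂ (hit (child i)))
    position : ∀ i → toℕ (lookup (child i) j₀) ≡ suc N ℕ.* toℕ (lookup a j₀) ℕ.+ toℕ i
    position i = trans (cong toℕ (Vec.lookup-zipWith combine j₀ a (Vec.replicate n i)))
      (trans (Fin.toℕ-combine (lookup a j₀) (lookup (Vec.replicate n i) j₀))
        (cong (λ l → suc N ℕ.* toℕ (lookup a j₀) ℕ.+ toℕ l) (Vec.lookup-replicate j₀ i)))
    disjoint : ∀ {i i′ x} → i Fin.< i′ → x ∈ cube (child i) → x ∉ cube (child i′)
    disjoint {i} {i′} {x} i<i′ x∈ x∈′ = proj₁ (x∈′ j₀) (<fromℚ-trans {x j₀} (proj₂ (x∈ j₀))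
      (÷-monoˡ-≤ W (subst₂ ℕ._<_ (sym (position i)) (sym (position i′))
        (ℕ.+-monoʳ-< (suc N ℕ.* toℕ (lookup a j₀)) i<i′))))
    decide : Dec (∃[ i ] N ℕ.≤ k i) → ∃[ k ] (N ℕ.≤ k) × (k ℕ.≤ q) × y k ∈ cube a
    decide (yes (i , N≤k)) = k i , N≤k , proj₁ (proj₂ (hit (child i))) ,
      cube-subcell-⊆ a (Vec.replicate n i) {y (k i)} (k∈ i)
    decide (no none) =
      let k<N = λ i → ℕ.≰⇒> λ N≤k → none (i , N≤k)
          i , i′ , i<i′ , eq = Fin.pigeonhole (ℕ.n<1+n N) (λ i → fromℕ< (k<N i))
          ki≡ki′ = trans (sym (Fin.toℕ-fromℕ< (k<N i))) (trans (cong toℕ eq) (Fin.toℕ-fromℕ< (k<N i′)))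
      in contradiction (subst (λ l → y l ∈ cube (child i′)) (sym ki≡ki′) (k∈ i′))
           (disjoint {i} {i′} {y (k i)} i<i′ (k∈ i))

  module _ (ξ : ℕ → Point n) where

    -- A single k ≥ N satisfies a_k ≤ 1 / (J + 1) at all points of the cell.
    Close : ∀ {L} .{{_ : NonZero L}} → (N J : ℕ) → Cell n L → Set
    Close N J a = ∃[ k ] (N ℕ.≤ k) × (∀ x → x ∈ cube a →
      Eventually (λ m → seq (scaledDistance k (ξ k) x) m ℚ.≤ 1 ÷ suc J))

    -- Every cell of level M contains some ξ_k with k ≥ N and k^(1/n) ≤ K M.
    LateHits : ∀ M .{{_ : NonZero M}} → (N K : ℕ) → Set
    LateHits M N K = (a : Cell n M) →
      ∃[ k ] (N ℕ.≤ k) × (k ℕ.≤ (K ℕ.* M) ℕ.^ n) × ξ k ∈ cube a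

    -- Apply the box property to the box B_{C,q} anchored at the lower corner of b.
    visits : ∀ C c q P .{{_ : NonZero c}} .{{_ : NonZero q}} .{{_ : NonZero P}} →
      Eventually (λ m → seq C m ℚ.≤ c ÷ 1) → (c ℕ.* P) ℕ.^ n ℕ.≤ q →
      (∀ (η : Point n) → η ∈ unitCube → box C q η ⊆ unitCube → ∃[ k ] (1 ℕ.≤ k) × (k ℕ.≤ q) × ξ k ∈ box C q η) →
      (b : Cell n P) → ∃[ k ] (k ℕ.≤ q) × ξ k ∈ cube b
    visits C c q P C≤c cPⁿ≤q boxes b =
      let k , _ , k≤q , k∈ = boxes (lower b) (cube-⊆-unitCube b {lower b} (lower∈cube b))
                               (λ {x} x∈ → cube-⊆-unitCube b {x} (inside {x} x∈))
      in k , k≤q , inside {ξ k} k∈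
      where
      inside : box C q (lower b) ⊆ cube b
      inside {x} = box⊆cube C c q P C≤c cPⁿ≤q b {x}

    -- The constant K does not depend on L: with c ≥ C an integer, the level M = L m
    -- satisfies (c (N + 1) M)ⁿ ≤ q ≤ (2 c (N + 1) M)ⁿ.
    lateHits : WellDistributed ξ → ∀ N → Σ[ K ∈ ℕ ] NonZero K ×
      (∀ L → (L≢0 : NonZero L) → Σ[ m ∈ ℕ ] Σ[ m≢0 ∈ NonZero m ]
        LateHits (L ℕ.* m) {{ℕ.m*n≢0 L m {{L≢0}} {{m≢0}}}} N K)
    lateHits (C , _ , hits) N = let c-1 , C≤c = natBound C in
      2 ℕ.* (suc c-1 ℕ.* suc N) , _ , λ L L≢0 → hitsAt (suc c-1) _ C≤c L L≢0
        (hits ((suc c-1 ℕ.* (L ℕ.* suc N)) ℕ.^ n))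
      where
      arrange : ∀ c L m N → m ℕ.* (c ℕ.* (L ℕ.* N)) ≡ c ℕ.* (L ℕ.* m ℕ.* N)
      arrange = solveℕ-∀
      arrange′ : ∀ c L m N → (m ℕ.+ m) ℕ.* (c ℕ.* (L ℕ.* N)) ≡ (2 ℕ.* (c ℕ.* N)) ℕ.* (L ℕ.* m)
      arrange′ = solveℕ-∀
      hitsAt : ∀ c (c≢0 : NonZero c) → Eventually (λ m → seq C m ℚ.≤ c ÷ 1) →
        ∀ L (L≢0 : NonZero L) →
        Σ[ q ∈ ℕ ] Σ[ q≢0 ∈ NonZero q ] ((c ℕ.* (L ℕ.* suc N)) ℕ.^ n ℕ.≤ q) ×
          (∀ (η : Point n) → η ∈ unitCube → box C q {{q≢0}} η ⊆ unitCube →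
            ∃[ k ] (1 ℕ.≤ k) × (k ℕ.≤ q) × ξ k ∈ box C q {{q≢0}} η) →
        Σ[ m ∈ ℕ ] Σ[ m≢0 ∈ NonZero m ]
          LateHits (L ℕ.* m) {{ℕ.m*n≢0 L m {{L≢0}} {{m≢0}}}} N (2 ℕ.* (c ℕ.* suc N))
      hitsAt c c≢0 C≤c L L≢0 (q , q≢0 , Bⁿ≤q , boxes) =
        let m , m≢0 , [mB]ⁿ≤q , q≤ = scale n (c ℕ.* (L ℕ.* suc N)) q
              {{ℕ.m*n≢0 c (L ℕ.* suc N) {{c≢0}} {{ℕ.m*n≢0 L (suc N) {{L≢0}}}}}} Bⁿ≤q
            Lm≢0 = ℕ.m*n≢0 L m {{L≢0}} {{m≢0}}
        in m , m≢0 , λ a →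
        let k , N≤k , k≤q , k∈ = late-visit ξ (L ℕ.* m) N q {{Lm≢0}}
              (visits C c q (L ℕ.* m ℕ.* suc N) {{c≢0}} {{q≢0}} {{ℕ.m*n≢0 (L ℕ.* m) (suc N) {{Lm≢0}}}} C≤c
                (subst (λ M → M ℕ.^ n ℕ.≤ q) (arrange c L m (suc N)) [mB]ⁿ≤q) boxes) a
        in k , N≤k , ℕ.≤-trans k≤q (subst (λ M → q ℕ.≤ M ℕ.^ n) (arrange′ c L m (suc N)) q≤) , k∈

    module _ {M N K : ℕ} (M≢0 : NonZero M) (K≢0 : NonZero K) (J : ℕ) (hits : LateHits M {{M≢0}} N K) where

      private
        r = fineness K J
        r≢0 = fineness≢0 K J {{K≢0}}

      -- The position of a subcell next to the point ξ_k that visits the cell.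
      hole : Cell n M → Cell n r
      hole a = let k , _ , _ , k∈ = hits a in
        tabulate λ j → proj₁ (locate r {{M≢0}} {{r≢0}} (lookup a j) (ξ k j) (k∈ j))

      hole-close : ∀ a → Close {{ℕ.m*n≢0 M r {{M≢0}} {{r≢0}}}} N J (subcell a (hole a))
      hole-close a = let k , N≤k , k≤ , k∈ = hits a in k , N≤k , λ x x∈ →
        map-ev (λ m h → ℚ.≤-trans h (÷-mono-≤ (K ℕ.* M ℕ.* 3) (M ℕ.* r) 1 (suc J)
                 (ℕ.≤-reflexive (arrange K M (suc J)))))
          (scaledDistance-ev-≤ k (K ℕ.* M) 3 (M ℕ.* r) (ξ k) x k≤ λ j →
            interval-close {{Mr≢0}} (combine (lookup a j) (lookup (hole a) j)) {x j} {ξ k j}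
              (subst (λ u → interval {{Mr≢0}} u (x j)) (Vec.lookup-zipWith combine j a (hole a)) (x∈ j))
              (subst (λ i → doubleInterval {{Mr≢0}} (combine (lookup a j) i) (ξ k j))
                (sym (Vec.lookup∘tabulate _ j))
                (proj₂ (locate r {{M≢0}} {{r≢0}} (lookup a j) (ξ k j) (k∈ j)))))
        where
        instance
          Mr≢0 : NonZero (M ℕ.* r)
          Mr≢0 = ℕ.m*n≢0 M r {{M≢0}} {{r≢0}}
        arrange : ∀ K M J → (K ℕ.* M ℕ.* 3) ℕ.* J ≡ 1 ℕ.* (M ℕ.* (3 ℕ.* (K ℕ.* J)))
        arrange = solveℕ-∀

------------------------------------------------------------------------
-- Lists of cells

length-cartesianProductWith : ∀ {A B C : Set} (f : A → B → C) xs ys →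
  length (cartesianProductWith f xs ys) ≡ length xs ℕ.* length ys
length-cartesianProductWith f []       ys = refl
length-cartesianProductWith f (x ∷ xs) ys = trans (List.length-++ (List.map (f x) ys))
  (cong₂ ℕ._+_ (List.length-map (f x) ys) (length-cartesianProductWith f xs ys))

length-concatMap-≤ : ∀ {A B : Set} (f : A → List B) b → (∀ x → length (f x) ℕ.≤ b) →
  ∀ xs → length (concatMap f xs) ℕ.≤ length xs ℕ.* b
length-concatMap-≤ f b h []       = ℕ.z≤n
length-concatMap-≤ f b h (x ∷ xs) = subst (ℕ._≤ b ℕ.+ length xs ℕ.* b) (sym (List.length-++ (f x)))
  (ℕ.+-mono-≤ (h x) (length-concatMap-≤ f b h xs))

-- All cells of level L.
grid : ∀ n L → List (Cell n L)
grid zero    L = [] ∷ []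
grid (suc n) L = cartesianProductWith _∷_ (allFin L) (grid n L)

∈-grid : ∀ {n L} (c : Cell n L) → c ∈ₗ grid n L
∈-grid []      = here refl
∈-grid (i ∷ c) = ∈-cartesianProductWith⁺ _∷_ (∈-allFin i) (∈-grid c)

length-grid : ∀ n L → length (grid n L) ≡ L ℕ.^ n
length-grid zero    L = refl
length-grid (suc n) L = trans (length-cartesianProductWith _∷_ (allFin L) (grid n L))
  (cong₂ ℕ._*_ (List.length-tabulate {n = L} (λ i → i)) (length-grid n L))

-- The subcells of the cells a of a list at the positions F a.
subdivide : ∀ {n L m} → (Cell n L → List (Cell n m)) → List (Cell n L) → List (Cell n (L ℕ.* m))
subdivide F = concatMap (λ a → List.map (subcell a) (F a))

∈-subdivide : ∀ {n L m} (F : Cell n L → List (Cell n m)) {S a b} →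
  a ∈ₗ S → b ∈ₗ F a → subcell a b ∈ₗ subdivide F S
∈-subdivide F {a = a} a∈S b∈Fa =
  ∈-concatMap⁺ (λ a → List.map (subcell a) (F a)) (lose a∈S (∈-map⁺ (subcell a) b∈Fa))

length-subdivide-≤ : ∀ {n L m} (F : Cell n L → List (Cell n m)) b → (∀ a → length (F a) ℕ.≤ b) →
  ∀ S → length (subdivide F S) ℕ.≤ length S ℕ.* b
length-subdivide-≤ F b h = length-concatMap-≤ (λ a → List.map (subcell a) (F a)) b
  λ a → subst (ℕ._≤ b) (sym (List.length-map (subcell a) (F a))) (h a)

------------------------------------------------------------------------
-- Covers by few cells

-- For a > 0 this is (1 + 1/a)^t ≥ 1 + t/a, multiplied by a^(t+1).
bernoulli : ∀ a t → a ℕ.^ t ℕ.* (a ℕ.+ t) ℕ.≤ suc a ℕ.^ t ℕ.* a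
bernoulli a zero    = ℕ.≤-reflexive (cong (1 ℕ.*_) (ℕ.+-identityʳ a))
bernoulli a (suc t) = begin
  a ℕ.* a ℕ.^ t ℕ.* (a ℕ.+ suc t)                    ≤⟨ ℕ.m≤m+n _ (a ℕ.^ t ℕ.* t) ⟩
  a ℕ.* a ℕ.^ t ℕ.* (a ℕ.+ suc t) ℕ.+ a ℕ.^ t ℕ.* t  ≡⟨ arrange a (a ℕ.^ t) t ⟩
  suc a ℕ.* (a ℕ.^ t ℕ.* (a ℕ.+ t))                  ≤⟨ ℕ.*-monoʳ-≤ (suc a) (bernoulli a t) ⟩
  suc a ℕ.* (suc a ℕ.^ t ℕ.* a)                      ≡⟨ ℕ.*-assoc (suc a) (suc a ℕ.^ t) a ⟨
  suc a ℕ.* suc a ℕ.^ t ℕ.* a                        ∎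
  where
  open ℕ.≤-Reasoning
  arrange : ∀ a p t → a ℕ.* p ℕ.* (a ℕ.+ suc t) ℕ.+ p ℕ.* t ≡ suc a ℕ.* (p ℕ.* (a ℕ.+ t))
  arrange = solveℕ-∀

decay : ∀ a X .{{_ : NonZero X}} → ∃[ t ] a ℕ.^ t ℕ.* X ℕ.≤ suc a ℕ.^ t
decay zero      X       = 1 , ℕ.z≤n
decay a@(suc _) X = t , ℕ.*-cancelʳ-≤ (a ℕ.^ t ℕ.* X) (suc a ℕ.^ t) a (begin
  a ℕ.^ t ℕ.* X ℕ.* a          ≡⟨ ℕ.*-assoc (a ℕ.^ t) X a ⟩
  a ℕ.^ t ℕ.* (X ℕ.* a)        ≤⟨ ℕ.*-monoʳ-≤ (a ℕ.^ t) (ℕ.m≤n+m (X ℕ.* a) a) ⟩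
  a ℕ.^ t ℕ.* (a ℕ.+ t)        ≤⟨ bernoulli a t ⟩
  suc a ℕ.^ t ℕ.* a            ∎)
  where
  open ℕ.≤-Reasoning
  t = X ℕ.* a

module _ {n : ℕ} .{{_ : NonZero n}} (ξ : ℕ → Point n) where

  -- The cells outside S consist of points at which a_k ≤ 1 / (J + 1) for some
  -- k ≥ N, so S covers the exceptional set.
  Covers : ∀ {L} .{{_ : NonZero L}} → (N J : ℕ) → List (Cell n L) → Set
  Covers N J S = ∀ a → a ∈ₗ S ⊎ Close ξ N J a

  close-subcell : ∀ {L m N J} .{{_ : NonZero L}} .{{_ : NonZero m}} (a : Cell n L) (b : Cell n m) →
    Close ξ N J a → Close ξ {{ℕ.m*n≢0 L m}} N J (subcell a b)
  close-subcell a b (k , N≤k , h) = k , N≤k , λ x x∈ → h x (cube-subcell-⊆ a b {x} x∈)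

  -- Passing to a finer grid multiplies the number of cells by mⁿ, which leaves
  -- the covered volume unchanged.
  refine : ∀ {L} m {N J} .{{_ : NonZero L}} .{{_ : NonZero m}} (S : List (Cell n L)) → Covers N J S →
    Σ[ S′ ∈ List (Cell n (L ℕ.* m)) ]
      (length S′ ℕ.≤ length S ℕ.* m ℕ.^ n) × Covers {{ℕ.m*n≢0 L m}} N J S′
  refine {L} m {N} {J} S cov = subdivide F S ,
    length-subdivide-≤ F (m ℕ.^ n) (λ _ → ℕ.≤-reflexive (length-grid n m)) S , cov′
    where
    F : Cell n L → List (Cell n m)
    F _ = grid n m
    instance
      Lm≢0 : NonZero (L ℕ.* m)
      Lm≢0 = ℕ.m*n≢0 L m
    cov′ : Covers N J (subdivide F S)
    cov′ c with subcell-surjective L m c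
    ... | a , b , refl with cov a
    ...   | inj₁ a∈S = inj₁ (∈-subdivide F a∈S (∈-grid b))
    ...   | inj₂ cl  = inj₂ (close-subcell a b cl)

  -- Discarding one subcell of each cell.
  thin : ∀ {M r N J} .{{_ : NonZero M}} .{{_ : NonZero r}} (hole : Cell n M → Cell n r) →
    (∀ a → Close ξ {{ℕ.m*n≢0 M r}} N J (subcell a (hole a))) →
    (S : List (Cell n M)) → Covers N J S →
    Σ[ S′ ∈ List (Cell n (M ℕ.* r)) ]
      (length S′ ℕ.≤ length S ℕ.* ℕ.pred (r ℕ.^ n)) × Covers {{ℕ.m*n≢0 M r}} N J S′
  thin {M} {r} {N} {J} hole hole-close S cov = subdivide F S ,
    length-subdivide-≤ F (ℕ.pred (r ℕ.^ n)) short S , cov′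
    where
    _≟_ : (b b′ : Cell n r) → Dec (b ≡ b′)
    _≟_ = Vec.≡-dec Fin._≟_
    F : Cell n M → List (Cell n r)
    F a = filter (λ b → ¬? (b ≟ hole a)) (grid n r)
    instance
      Mr≢0 : NonZero (M ℕ.* r)
      Mr≢0 = ℕ.m*n≢0 M r
    short : ∀ a → length (F a) ℕ.≤ ℕ.pred (r ℕ.^ n)
    short a = ℕ.pred-mono-≤ (subst (length (F a) ℕ.<_) (length-grid n r)
      (List.filter-notAll (λ b → ¬? (b ≟ hole a)) (grid n r)
        (lose (∈-grid (hole a)) λ ≢hole → ≢hole refl)))
    cov′ : Covers N J (subdivide F S)
    cov′ c with subcell-surjective M r c
    ... | a , b , refl with b ≟ hole a
    ...   | yes refl = inj₂ (hole-close a)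
    ...   | no b≢ with cov a
    ...     | inj₁ a∈S = inj₁ (∈-subdivide F a∈S (∈-filter⁺ (λ b → ¬? (b ≟ hole a)) (∈-grid b) b≢))
    ...     | inj₂ cl  = inj₂ (close-subcell a b cl)

  -- A cover by at most the fraction ((b - 1) / b)^t of all cells of some level,
  -- where b is suc b-1.
  CoverAfter : (N J b-1 t : ℕ) → Set
  CoverAfter N J b-1 t = Σ[ L ∈ ℕ ] Σ[ L≢0 ∈ NonZero L ] Σ[ S ∈ List (Cell n L) ]
    (length S ℕ.* suc b-1 ℕ.^ t ℕ.≤ b-1 ℕ.^ t ℕ.* L ℕ.^ n) × Covers {{L≢0}} N J S

  -- One step of the iteration, with b = rⁿ.
  improve : ∀ {N J} K (K≢0 : NonZero K) →
    (∀ L → (L≢0 : NonZero L) → Σ[ m ∈ ℕ ] Σ[ m≢0 ∈ NonZero m ]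
      LateHits ξ (L ℕ.* m) {{ℕ.m*n≢0 L m {{L≢0}} {{m≢0}}}} N K) →
    ∀ b-1 → suc b-1 ≡ fineness K J ℕ.^ n →
    ∀ t → CoverAfter N J b-1 t → CoverAfter N J b-1 (suc t)
  improve {N} {J} K K≢0 hits b-1 b≡ t (L , L≢0 , S , sparse , covers) =
    let m , m≢0 , hitsL = hits L L≢0
        M≢0 = ℕ.m*n≢0 L m {{L≢0}} {{m≢0}}
        r≢0 = fineness≢0 K J {{K≢0}}
        S₁ , short₁ , covers₁ = refine m {N} {J} {{L≢0}} {{m≢0}} S covers
        S₂ , short₂ , covers₂ = thin {N = N} {J} {{M≢0}} {{r≢0}}
          (hole ξ M≢0 K≢0 J hitsL) (hole-close ξ M≢0 K≢0 J hitsL) S₁ covers₁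
    in L ℕ.* m ℕ.* r , ℕ.m*n≢0 (L ℕ.* m) r {{M≢0}} {{r≢0}} , S₂ ,
       count m (length S₁) (length S₂) short₁
         (subst (λ b → length S₂ ℕ.≤ length S₁ ℕ.* ℕ.pred b) (sym b≡) short₂) , covers₂
    where
    open ℕ.≤-Reasoning
    r = fineness K J
    arrange : ∀ s m a b p → (s ℕ.* m ℕ.* a) ℕ.* (b ℕ.* p) ≡ (s ℕ.* p) ℕ.* (m ℕ.* a ℕ.* b)
    arrange = solveℕ-∀
    arrange′ : ∀ a l m b p → (p ℕ.* l) ℕ.* (m ℕ.* a ℕ.* b) ≡ (a ℕ.* p) ℕ.* (l ℕ.* m ℕ.* b)
    arrange′ = solveℕ-∀
    count : ∀ m s₁ s₂ → s₁ ℕ.≤ length S ℕ.* m ℕ.^ n → s₂ ℕ.≤ s₁ ℕ.* b-1 →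
      s₂ ℕ.* suc b-1 ℕ.^ suc t ℕ.≤ b-1 ℕ.^ suc t ℕ.* (L ℕ.* m ℕ.* r) ℕ.^ n
    count m s₁ s₂ h₁ h₂ = begin
      s₂ ℕ.* suc b-1 ℕ.^ suc t
        ≤⟨ ℕ.*-monoˡ-≤ (suc b-1 ℕ.^ suc t) (ℕ.≤-trans h₂ (ℕ.*-monoˡ-≤ b-1 h₁)) ⟩
      (length S ℕ.* m ℕ.^ n ℕ.* b-1) ℕ.* (suc b-1 ℕ.* suc b-1 ℕ.^ t)
        ≡⟨ arrange (length S) (m ℕ.^ n) b-1 (suc b-1) (suc b-1 ℕ.^ t) ⟩
      (length S ℕ.* suc b-1 ℕ.^ t) ℕ.* (m ℕ.^ n ℕ.* b-1 ℕ.* suc b-1)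
        ≤⟨ ℕ.*-monoˡ-≤ (m ℕ.^ n ℕ.* b-1 ℕ.* suc b-1) sparse ⟩
      (b-1 ℕ.^ t ℕ.* L ℕ.^ n) ℕ.* (m ℕ.^ n ℕ.* b-1 ℕ.* suc b-1)
        ≡⟨ arrange′ b-1 (L ℕ.^ n) (m ℕ.^ n) (suc b-1) (b-1 ℕ.^ t) ⟩
      (b-1 ℕ.* b-1 ℕ.^ t) ℕ.* (L ℕ.^ n ℕ.* m ℕ.^ n ℕ.* suc b-1)
        ≡⟨ cong (b-1 ℕ.^ suc t ℕ.*_) (trans (cong₂ ℕ._*_ (^-distrib-* L m n) b≡) (^-distrib-* (L ℕ.* m) r n)) ⟩
      b-1 ℕ.^ suc t ℕ.* (L ℕ.* m ℕ.* r) ℕ.^ n ∎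

  iterate : WellDistributed ξ → ∀ N J → ∃[ b-1 ] ∀ t → CoverAfter N J b-1 t
  iterate wd N J =
    let K , K≢0 , hits = lateHits ξ wd N
        r = fineness K J
        r≢0 = fineness≢0 K J {{K≢0}}
    in ℕ.pred (r ℕ.^ n) , go (ℕ.pred (r ℕ.^ n))
         (improve K K≢0 hits (ℕ.pred (r ℕ.^ n)) (ℕ.suc-pred (r ℕ.^ n) {{ℕ.m^n≢0 r n {{r≢0}}}}))
    where
    go : ∀ b-1 → (∀ t → CoverAfter N J b-1 t → CoverAfter N J b-1 (suc t)) → ∀ t → CoverAfter N J b-1 t
    go b-1 step zero    = 1 , _ , grid n 1 , ℕ.≤-reflexive (begin
      length (grid n 1) ℕ.* 1   ≡⟨ ℕ.*-identityʳ (length (grid n 1)) ⟩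
      length (grid n 1)         ≡⟨ length-grid n 1 ⟩
      1 ℕ.^ n                   ≡⟨ ℕ.*-identityˡ (1 ℕ.^ n) ⟨
      1 ℕ.* 1 ℕ.^ n             ∎) , λ a → inj₁ (∈-grid a)
      where open ≡-Reasoning
    go b-1 step (suc t) = step t (go b-1 step t)

  -- A cover of volume at most 1 / X.
  sparseCover : WellDistributed ξ → ∀ N J X .{{_ : NonZero X}} →
    Σ[ L ∈ ℕ ] Σ[ L≢0 ∈ NonZero L ] Σ[ S ∈ List (Cell n L) ]
      (length S ℕ.* X ℕ.≤ L ℕ.^ n) × Covers {{L≢0}} N J S
  sparseCover wd N J X =
    let a , stage = iterate wd N J
        t , aᵗX≤ = decay a X
        L , L≢0 , S , sparse , covers = stage t
    in L , L≢0 , S , dense a t (length S) (L ℕ.^ n) aᵗX≤ sparse , covers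
    where
    open ℕ.≤-Reasoning
    arrange : ∀ s X p → s ℕ.* X ℕ.* p ≡ s ℕ.* p ℕ.* X
    arrange = solveℕ-∀
    arrange′ : ∀ a l X → a ℕ.* l ℕ.* X ≡ l ℕ.* (a ℕ.* X)
    arrange′ = solveℕ-∀
    dense : ∀ a t s l → a ℕ.^ t ℕ.* X ℕ.≤ suc a ℕ.^ t →
      s ℕ.* suc a ℕ.^ t ℕ.≤ a ℕ.^ t ℕ.* l → s ℕ.* X ℕ.≤ l
    dense a t s l h₁ h₂ = ℕ.*-cancelʳ-≤ (s ℕ.* X) l (suc a ℕ.^ t) {{ℕ.m^n≢0 (suc a) t}} (begin
      s ℕ.* X ℕ.* suc a ℕ.^ t      ≡⟨ arrange s X (suc a ℕ.^ t) ⟩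
      s ℕ.* suc a ℕ.^ t ℕ.* X      ≤⟨ ℕ.*-monoˡ-≤ X h₂ ⟩
      a ℕ.^ t ℕ.* l ℕ.* X          ≡⟨ arrange′ (a ℕ.^ t) l X ⟩
      l ℕ.* (a ℕ.^ t ℕ.* X)        ≤⟨ ℕ.*-monoʳ-≤ l h₁ ⟩
      l ℕ.* suc a ℕ.^ t            ∎)

------------------------------------------------------------------------
-- Points outside a cover

module _ {n : ℕ} .{{_ : NonZero n}} (ξ : ℕ → Point n) where

  search : ∀ {A Q : Set} {P : A → Set} → (∀ a → P a ⊎ Q) → ∀ xs → All P xs ⊎ Q
  search f []       = inj₁ []
  search f (a ∷ as) with f a | search f as
  ... | inj₂ q | _       = inj₂ q
  ... | inj₁ _ | inj₂ q  = inj₂ q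
  ... | inj₁ p | inj₁ ps = inj₁ (p ∷ ps)

  approached : ∀ {L N J} .{{_ : NonZero L}} {S : List (Cell n L)} → Covers ξ N J S →
    ∀ {e} → 1 ÷ suc J ℚ.< e → ∀ x → x ∈ unitCube → (∀ {a} → a ∈ₗ S → x ∉ cube a) →
    ∃[ k ] (N ≤ℕ k) × (scaledDistance k (ξ k) x < fromℚ e)
  approached {L} {N} {J} {S} cov {e} 1/J<e x x∈ x∉S = conclude (search test (grid n L))
    where
    Found = ∃[ k ] (N ≤ℕ k) × (scaledDistance k (ξ k) x < fromℚ e)
    test : ∀ a → x ∉ cube a ⊎ Found
    test a with cov a
    ... | inj₁ a∈S = inj₁ (x∉S a∈S)
    ... | inj₂ (k , N≤k , close) with compare (scaledDistance k (ξ k) x) 1/J<e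
    ...   | inj₁ <e   = inj₂ (k , N≤k , <e)
    ...   | inj₂ 1/J< = inj₁ λ x∈a →
      ev-≤⇒≤ {scaledDistance k (ξ k) x} {fromℚ (1 ÷ suc J)} (close x x∈a) 1/J<
    conclude : All (λ a → x ∉ cube a) (grid n L) ⊎ Found → Found
    conclude (inj₂ found) = found
    conclude (inj₁ avoid) = contradiction
      (λ (c , x∈c) → All.lookup avoid (∈-grid c) x∈c) (¬¬cube L x x∈)

------------------------------------------------------------------------
-- Concatenation of an infinite sequence of finite lists

sumℚ : (ℕ → ℚ) → ℕ → ℚ
sumℚ f zero    = 0ℚ
sumℚ f (suc i) = sumℚ f i ℚ.+ f i

module Concatenation {A : Set} (lists : ℕ → List A) where

  -- A state consists of the index of the list being read and of what remains of
  -- it.  Passing on to the next list takes a step of its own, at which nothing is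
  -- emitted; this makes the enumeration total even if the lists are empty.
  next : ℕ × List A → ℕ × List A
  next (j , [])     = suc j , lists (suc j)
  next (j , _ ∷ xs) = j , xs

  emit : ℕ × List A → Maybe A
  emit (_ , [])    = nothing
  emit (_ , x ∷ _) = just x

  state : ℕ → ℕ × List A
  state zero    = 0 , lists 0
  state (suc i) = next (state i)

  concatenation : ℕ → Maybe A
  concatenation i = emit (state i)

  exhaust : ∀ xs {i j} → state i ≡ (j , xs) → ∃[ i′ ] state i′ ≡ (j , [])
  exhaust []       {i} eq = i , eq
  exhaust (x ∷ xs) {i} eq = exhaust xs {suc i} (cong next eq)

  reach : ∀ j → ∃[ i ] state i ≡ (j , lists j)
  reach zero    = 0 , refl
  reach (suc j) = let i , eq = reach j ; i′ , eq′ = exhaust (lists j) {i} eq in suc i′ , cong next eq′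

  appears : ∀ {j x} → x ∈ₗ lists j → ∃[ i ] concatenation i ≡ just x
  appears {j} x∈ = let i , eq = reach j in go x∈ i eq
    where
    go : ∀ {xs x} → x ∈ₗ xs → ∀ i → state i ≡ (j , xs) → ∃[ i ] concatenation i ≡ just x
    go (here refl) i eq = i , cong emit eq
    go (there x∈)  i eq = go x∈ (suc i) (cong next eq)

  module _ (v : A → ℚ) where

    -- Total weights, where a silent step has weight zero.
    weight : Maybe A → ℚ
    weight = maybe′ v 0ℚ

    mass : List A → ℚ
    mass []       = 0ℚ
    mass (x ∷ xs) = v x ℚ.+ mass xs

    0≤mass : (∀ x → 0ℚ ℚ.≤ v x) → ∀ xs → 0ℚ ℚ.≤ mass xs
    0≤mass 0≤v []       = ℚ.≤-refl
    0≤mass 0≤v (x ∷ xs) = ℚ.≤-trans (0≤v x) (p≤p+q (v x) (0≤mass 0≤v xs))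

    -- The weight emitted so far together with that of the rest of the current list
    -- stays within the budget of the lists read up to now.
    total-≤ : (∀ x → 0ℚ ℚ.≤ v x) → ∀ (β : ℕ → ℚ) {e} → (∀ j → mass (lists j) ℚ.≤ β j) → (∀ j → sumℚ β j ℚ.≤ e) →
      ∀ i → sumℚ (λ i → weight (concatenation i)) i ℚ.≤ e
    total-≤ 0≤v β {e} mass≤β Σβ≤e i = ℚ.≤-trans (p≤p+q (total i) (0≤mass 0≤v (proj₂ (state i))))
      (ℚ.≤-trans (invariant i) (Σβ≤e (suc (proj₁ (state i)))))
      where
      total = sumℚ (λ i → weight (concatenation i))
      step : ∀ s t → t ℚ.+ mass (proj₂ s) ℚ.≤ sumℚ β (suc (proj₁ s)) →
        (t ℚ.+ weight (emit s)) ℚ.+ mass (proj₂ (next s)) ℚ.≤ sumℚ β (suc (proj₁ (next s)))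
      step (j , [])     t h = ℚ.+-mono-≤ h (mass≤β (suc j))
      step (j , x ∷ xs) t h = subst (ℚ._≤ sumℚ β (suc j)) (sym (ℚ.+-assoc t (v x) (mass xs))) h
      invariant : ∀ i → total i ℚ.+ mass (proj₂ (state i)) ℚ.≤ sumℚ β (suc (proj₁ (state i)))
      invariant zero    = ℚ.+-monoʳ-≤ 0ℚ (mass≤β 0)
      invariant (suc i) = step (state i) (total i) (invariant i)

    mass-map : ∀ {B : Set} (f : B → A) d .{{_ : NonZero d}} → (∀ b → v (f b) ≡ 1 ÷ d) →
      ∀ bs → mass (List.map f bs) ≡ length bs ÷ d
    mass-map f d h []       = ℚ.≤-antisym (0≤÷ 0 d) (subst (0 ÷ d ℚ.≤_) 0÷1≡0 (÷-mono-≤ 0 d 0 1 ℕ.z≤n))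
    mass-map f d h (b ∷ bs) = trans (cong₂ ℚ._+_ (h b) (mass-map f d h bs)) (÷-+ 1 (length bs) d)

------------------------------------------------------------------------
-- Volumes

product-const : ∀ {n} (f : Vector ℝ n) L .{{_ : NonZero L}} m → (∀ j → seq (f j) m ≡ 1 ÷ L) →
  seq (product f) m ≡ (1 ÷ (L ℕ.^ n)) {{ℕ.m^n≢0 L n}}
product-const {zero}  f L m h = sym 1÷1≡1
product-const {suc n} f L m h = trans (seq-* (f Fin.zero) (product (Vector.tail f)) m)
  (trans (cong₂ ℚ._*_ (h Fin.zero) (product-const (Vector.tail f) L m λ j → h (Fin.suc j)))
    (÷-* 1 1 L (L ℕ.^ n) {{_}} {{ℕ.m^n≢0 L n}}))

volume-cube : ∀ {n L} .{{_ : NonZero L}} (c : Cell n L) m →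
  seq (volume (lower c) (upper c)) m ≡ (1 ÷ (L ℕ.^ n)) {{ℕ.m^n≢0 L n}}
volume-cube {L = L} c m = product-const (λ j → upper c j - lower c j) L m λ j →
  let u = toℕ (lookup c j) in
  trans (seq-- (upper c j) (lower c j) m) (trans (cong (ℚ._- u ÷ L)
    (trans (sym (÷-+ 1 u L)) (ℚ.+-comm (1 ÷ L) (u ÷ L)))) ([y+ε]-y≡ε (u ÷ L) (1 ÷ L)))

volume-empty : ∀ {n} .{{_ : NonZero n}} (x : Point n) m → seq (volume x x) m ≡ 0ℚ
volume-empty {suc n} x m = trans (seq-* (x Fin.zero - x Fin.zero) rest m)
  (trans (cong (ℚ._* seq rest m) (trans (seq-- (x Fin.zero) (x Fin.zero) m) (ℚ.+-inverseʳ (seq (x Fin.zero) m))))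
    (ℚ.*-zeroˡ (seq rest m)))
  where
  rest = product (Vector.tail (λ j → x j - x j))

-- A cell of any level.
record GridCell (n : ℕ) : Set where
  constructor gridCell
  field
    level   : ℕ
    level≢0 : NonZero level
    cell    : Cell n level

vol : ∀ {n} → GridCell n → ℚ
vol {n} (gridCell L L≢0 _) = (1 ÷ (L ℕ.^ n)) {{ℕ.m^n≢0 L n {{L≢0}}}}

0≤vol : ∀ {n} (g : GridCell n) → 0ℚ ℚ.≤ vol g
0≤vol {n} (gridCell L L≢0 _) = 0≤÷ 1 (L ℕ.^ n) {{ℕ.m^n≢0 L n {{L≢0}}}}

-- The corners of the box of a cell; nothing stands for an empty box.
boxLo boxHi : ∀ {n} → Maybe (GridCell n) → Point n
boxLo nothing                   = λ _ → 0ℝ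
boxLo (just (gridCell _ L≢0 a)) = lower {{L≢0}} a
boxHi nothing                   = λ _ → 0ℝ
boxHi (just (gridCell _ L≢0 a)) = upper {{L≢0}} a

boxLo≤boxHi : ∀ {n} (g : Maybe (GridCell n)) j → boxLo g j ≤ boxHi g j
boxLo≤boxHi nothing                   j = fromℚ-mono-≤ ℚ.≤-refl
boxLo≤boxHi (just (gridCell _ L≢0 a)) j = lower≤upper {{L≢0}} a j

module _ (E : ℕ) .{{_ : NonZero E}} where

  -- The shares 1 / (2^j E) for j ≥ 1 add up to 1 / E.
  share⁻¹ : ℕ → ℕ
  share⁻¹ j = 2 ℕ.^ j ℕ.* E

  share⁻¹≢0 : ∀ j → NonZero (share⁻¹ j)
  share⁻¹≢0 j = ℕ.m*n≢0 (2 ℕ.^ j) E {{ℕ.m^n≢0 2 j}}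

  share : ℕ → ℚ
  share j = (1 ÷ share⁻¹ j) {{share⁻¹≢0 j}}

  share-halves : ∀ j → share (suc j) ℚ.+ share (suc j) ≡ share j
  share-halves j = trans (÷-+ 1 1 (share⁻¹ (suc j)))
    (ℚ.≤-antisym (÷-mono-≤ 2 (share⁻¹ (suc j)) 1 (share⁻¹ j) (ℕ.≤-reflexive eq))
      (÷-mono-≤ 1 (share⁻¹ j) 2 (share⁻¹ (suc j)) (ℕ.≤-reflexive (sym eq))))
    where
    instance
      _ = share⁻¹≢0 j
      _ = share⁻¹≢0 (suc j)
    arrange : ∀ p E → 2 ℕ.* (p ℕ.* E) ≡ 1 ℕ.* (2 ℕ.* p ℕ.* E)
    arrange = solveℕ-∀
    eq = arrange (2 ℕ.^ j) E

  Σshare : ∀ j → sumℚ (λ i → share (suc i)) j ℚ.+ share j ≡ share 0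
  Σshare zero    = ℚ.+-identityˡ (share 0)
  Σshare (suc j) = trans (ℚ.+-assoc (sumℚ (λ i → share (suc i)) j) (share (suc j)) (share (suc j)))
    (trans (cong (sumℚ (λ i → share (suc i)) j ℚ.+_) (share-halves j)) (Σshare j))

  Σshare≤ : ∀ j → sumℚ (λ i → share (suc i)) j ℚ.≤ 1 ÷ E
  Σshare≤ j = begin
    sumℚ (λ i → share (suc i)) j               ≤⟨ p≤p+q (sumℚ (λ i → share (suc i)) j) (0≤÷ 1 (share⁻¹ j) {{share⁻¹≢0 j}}) ⟩
    sumℚ (λ i → share (suc i)) j ℚ.+ share j   ≡⟨ Σshare j ⟩
    share 0                                    ≡⟨ ÷-cong {{share⁻¹≢0 0}} refl (ℕ.*-identityˡ E) ⟩
    1 ÷ E                                      ∎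
    where open ℚ.≤-Reasoning

------------------------------------------------------------------------
-- The lower limit

seq-partialSum : ∀ (f : ℕ → ℝ) (g : ℕ → ℚ) m → (∀ i → seq (f i) m ≡ g i) →
  ∀ i → seq (partialSum f i) m ≡ sumℚ g i
seq-partialSum f g m h zero    = refl
seq-partialSum f g m h (suc i) =
  trans (seq-+ (partialSum f i) (f i) m) (cong₂ ℚ._+_ (seq-partialSum f g m h i) (h i))

-- The lower bound required of a lower limit is trivial here, as the terms are
-- nonnegative.
isLimInf0 : ∀ {n} .{{_ : NonZero n}} (ξ : ℕ → Point n) x →
  (∀ N {e} → 0ℚ ℚ.< e → ∃[ k ] (N ≤ℕ k) × (scaledDistance k (ξ k) x < fromℚ e)) →
  IsLimInf (λ k → scaledDistance k (ξ k) x) 0ℝ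
isLimInf0 ξ x h ε 0<ε = let e , 0<e , e≤ε = 0<⇒rational {ε} 0<ε in
  (0 , λ k _ → e , 0<e , map-ev (λ m e≤ → ℚ.≤-trans (ℚ.≤-reflexive (cong (ℚ._+ e) (seq-- 0ℝ ε m)))
    (ℚ.≤-trans (-ε+e≤0 (seq ε m) e e≤) (0≤scaledDistance k (ξ k) x m))) e≤ε) ,
  λ N → let k , N≤k , <e = h N 0<e in k , N≤k ,
    <-respʳ-ev {scaledDistance k (ξ k) x} {fromℚ e} {0ℝ + ε} <e (map-ev (λ m e≤ →
      subst (e ℚ.≤_) (sym (trans (seq-+ 0ℝ ε m) (ℚ.+-identityˡ (seq ε m)))) e≤) e≤ε)
  where
  -ε+e≤0 : ∀ s e → e ℚ.≤ s → (0ℚ ℚ.- s) ℚ.+ e ℚ.≤ 0ℚ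
  -ε+e≤0 s e e≤s = ℚ.≤-trans (ℚ.+-monoʳ-≤ (0ℚ ℚ.- s) e≤s) (ℚ.≤-reflexive
    (trans (cong (ℚ._+ s) (ℚ.+-identityˡ (ℚ.- s))) (ℚ.+-inverseˡ s)))

theorem1 : (n : ℕ) .{{_ : NonZero n}} (ξ : ℕ → Point n) →
    (∀ k → 1 ≤ℕ k → ξ k ∈ unitCube) →
    WellDistributed ξ →
    AlmostEverywhere (λ η → η ∈ unitCube →
    IsLimInf (λ k → root n k 1 * maximum (λ j → ‖ ξ k j - η j ‖)) 0ℝ)
theorem1 n ξ _ wd ε 0<ε = lo , hi , (λ i → boxLo≤boxHi (concatenation i)) , total≤ε , outside
  where
  e = proj₁ (0<⇒rational {ε} 0<ε)
  0<e = proj₁ (proj₂ (0<⇒rational {ε} 0<ε))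
  e≤ε = proj₂ (proj₂ (0<⇒rational {ε} 0<ε))
  -- 1 / E ≤ e ≤ ε
  E = ↧ₙ e
  -- N = J = j, so that every pair of bounds is eventually exceeded.
  stage : ∀ j → Σ[ L ∈ ℕ ] Σ[ L≢0 ∈ NonZero L ] Σ[ S ∈ List (Cell n L) ]
    (length S ℕ.* share⁻¹ E (suc j) ≤ℕ L ℕ.^ n) × Covers ξ {{L≢0}} j j S
  stage j = sparseCover ξ wd j j (share⁻¹ E (suc j)) {{share⁻¹≢0 E (suc j)}}
  lists : ℕ → List (GridCell n)
  lists j = let L , L≢0 , S , _ = stage j in List.map (gridCell L L≢0) S
  open Concatenation lists
  lo hi : ℕ → Point n
  lo i = boxLo (concatenation i)
  hi i = boxHi (concatenation i)
  mass≤ : ∀ j → mass vol (lists j) ℚ.≤ share E (suc j)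
  mass≤ j = let L , L≢0 , S , sparse , _ = stage j
                Lⁿ≢0 = ℕ.m^n≢0 L n {{L≢0}} in
    subst (ℚ._≤ share E (suc j))
      (sym (mass-map vol (gridCell L L≢0) (L ℕ.^ n) {{Lⁿ≢0}} (λ _ → refl) S))
      (÷-mono-≤ (length S) (L ℕ.^ n) 1 (share⁻¹ E (suc j)) {{Lⁿ≢0}} {{share⁻¹≢0 E (suc j)}}
        (subst (length S ℕ.* share⁻¹ E (suc j) ≤ℕ_) (sym (ℕ.*-identityˡ (L ℕ.^ n))) sparse))
  volume≡ : ∀ m (g : Maybe (GridCell n)) → seq (volume (boxLo g) (boxHi g)) m ≡ weight vol g
  volume≡ m nothing                   = volume-empty (λ _ → 0ℝ) m
  volume≡ m (just (gridCell _ L≢0 a)) = volume-cube {{L≢0}} a m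
  total≤ε : ∀ i → partialSum (λ i → volume (lo i) (hi i)) i ≤ ε
  total≤ε i = ev-≤⇒≤ {partialSum (λ i → volume (lo i) (hi i)) i} {ε} (map-ev (λ m e≤ → begin
    seq (partialSum (λ i → volume (lo i) (hi i)) i) m
      ≡⟨ seq-partialSum (λ i → volume (lo i) (hi i)) _ m (λ i → volume≡ m (concatenation i)) i ⟩
    sumℚ (λ i → weight vol (concatenation i)) i
      ≤⟨ total-≤ vol 0≤vol (λ j → share E (suc j)) mass≤ (Σshare≤ E) i ⟩
    1 ÷ E
      ≤⟨ 1÷↧ₙ-≤ {e} 0<e ⟩
    e
      ≤⟨ e≤ ⟩
    seq ε m ∎) e≤ε)
    where open ℚ.≤-Reasoning
  outside : ∀ x → (∀ i → x ∉ ⟦ lo i , hi i ⟩) → x ∈ unitCube →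
    IsLimInf (λ k → root n k 1 * maximum (λ j → ‖ ξ k j - x j ‖)) 0ℝ
  outside x x∉ x∈ = isLimInf0 ξ x λ N {δ} 0<δ →
    let j = N ℕ.⊔ ↧ₙ δ
        L , L≢0 , S , _ , covers = stage j
        k , j≤k , close = approached ξ {N = j} {j} {{L≢0}} covers {δ} (1÷suc< 0<δ (ℕ.m≤n⊔m N (↧ₙ δ))) x x∈
          λ {a} a∈S x∈a → let i , eq = appears {j} (∈-map⁺ (gridCell L L≢0) a∈S) in
            x∉ i (subst (λ g → x ∈ ⟦ boxLo g , boxHi g ⟩) (sym eq) x∈a)
    in k , ℕ.≤-trans (ℕ.m≤m⊔n N (↧ₙ δ)) j≤k , close
    where
    1÷suc< : ∀ {δ j} → 0ℚ ℚ.< δ → ↧ₙ δ ≤ℕ j → 1 ÷ suc j ℚ.< δ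
    1÷suc< {δ} {j} 0<δ h = ℚ.<-≤-trans (÷-mono-< 1 (suc j) 1 (↧ₙ δ)
      (ℕ.*-monoʳ-< 1 (ℕ.s≤s h))) (1÷↧ₙ-≤ {δ} 0<δ)
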